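{- Let $c,k$ be fixed positive integers with $c\le k$, and let $s=s(n)$ be an integer-valued function with $s(n)\ge c$ for all $n$. If $s(n)=\omega(n^{1/c^2})$ as $n\to\infty$, then $p(n,c,k,s(n))=1-o(1)$, i.e. $\lim_{n\to\infty}p(n,c,k,s(n))=1$.
   Context: $C_n^k$ denotes the $k$-th power of the cycle on $n$ vertices: its vertex set is $\{0,\ldots,n-1\}$, and distinct vertices $i,j$ are adjacent iff $(i-j) \bmod n\in\{ -k,\ldots,-1,1,\ldots,k\}$ (residues modulo $n$), i.e. iff their distance along the cycle is at most $k$. Given a set $L(x)$ of colours for each vertex $x$ of a graph $G$, an $L$-colouring of $G$ is a map $f$ from $V(G)$ to the colours with $f(x)\in L(x)$ for all $x\in V(G)$ and $f(x)\ne f(y)$ for every edge $(x,y)\in E(G)$; $G$ is $L$-colourable if it has an $L$-colouring. Let $\mathcal{S}$ be a set of colours of size $s(n)$. For each vertex of $C_n^k$, independently, draw a subset of $\mathcal{S}$ of size $c$ uniformly at random among all $c$-element subsets of $\mathcal{S}$; this gives a random list assignment $L$. Then $p(n,c,k,s(n))$ is the probability that $C_n^k$ is $L$-colourable. The parameters $c,k$ are fixed and all asymptotics are as $n\to\infty$; $f=o(g)$ means $\lim_{n\to\infty} f/g=0$, and $f=\omega(g)$ means $g=o(f)$. -}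

module Defs where

open import Algebra.Bundles using (CommutativeRing)
open import Data.Fin as Fin using (Fin; toℕ)
import Data.Fin.Properties as Fin
open import Data.Fin.Subset using (Subset; inside; outside; ∣_∣; _∈_)
open import Data.Fin.Subset.Properties using (_∈?_)
open import Data.Integer as ℤ using (ℤ; +_)
open import Data.Integer.Divisibility.Signed using (_∣_; _∣?_; ∣m⇒∣-m)
import Data.Integer.Properties as ℤ
open import Data.List as List using (List; []; _∷_; length; filter; cartesianProductWith; allFin)
open import Data.List.Membership.Propositional using (find; lose) renaming (_∈_ to _∈ˡ_)
open import Data.List.Membership.Propositional.Properties
  using (∈-filter⁺; ∈-filter⁻; ∈-cartesianProductWith⁺; ∈-cartesianProductWith⁻; ∈-allFin)
import Data.List.Relation.Unary.All as All
import Data.List.Relation.Unary.AllPairs as AllPairs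
import Data.List.Relation.Unary.Any as Any
open import Data.List.Relation.Unary.Any using (here; there)
open import Data.List.Relation.Unary.Unique.Propositional using (Unique)
import Data.List.Relation.Unary.Unique.Propositional.Properties as Unique
open import Data.Nat as ℕ using (ℕ; zero; suc; z≤n; s≤s)
import Data.Nat.Properties as ℕ
open import Data.Product using (Σ; ∃; _×_; _,_; proj₁; proj₂)
open import Data.Rational as ℚ using (ℚ; 0ℚ; 1ℚ)
import Data.Rational.Properties as ℚ
open import Data.Sum as Sum using (_⊎_; inj₁; inj₂)
open import Data.Vec as Vec using (Vec; []; _∷_; lookup; tabulate)
import Data.Vec.Properties as Vec
open import Function using (_⇔_; mk⇔; Equivalence)
open import Relation.Binary.PropositionalEquality
open import Relation.Nullary using (¬_; Dec; map′; _×-dec_; _⊎-dec_; _→-dec_; ¬?)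
open import Relation.Unary using (Decidable)
open import Algebra.Properties.Semiring.Exp
  (CommutativeRing.semiring ℚ.+-*-commutativeRing) using (_^_)

record Graph (n : ℕ) : Set₁ where
  field
    Adj    : Fin n → Fin n → Set
    adj?   : ∀ i j → Dec (Adj i j)
    symm   : ∀ {i j} → Adj i j → Adj j i
    irrefl : ∀ {i} → ¬ Adj i i

open Graph using (Adj; adj?)

-- i - j is congruent modulo n to one of -k, …, -1, 1, …, k; the offset is
-- suc (toℕ d) because d ranges over 0, …, k - 1.
CycleDistance : (n k : ℕ) → Fin n → Fin n → Set
CycleDistance n k i j = ∃ λ (d : Fin k) →
  (+ n ∣ (+ toℕ i ℤ.- + toℕ j) ℤ.- + suc (toℕ d)) ⊎
  (+ n ∣ (+ toℕ i ℤ.- + toℕ j) ℤ.+ + suc (toℕ d))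

private
  negate₁ : ∀ a b c → ℤ.- ((a ℤ.- b) ℤ.- c) ≡ (b ℤ.- a) ℤ.+ c
  negate₁ a b c = trans (ℤ.neg-distrib-+ (a ℤ.- b) (ℤ.- c))
    (cong₂ ℤ._+_ (trans (ℤ.neg-distrib-+ a (ℤ.- b))
      (trans (ℤ.+-comm (ℤ.- a) _) (cong (ℤ._+ ℤ.- a) (ℤ.neg-involutive b))))
      (ℤ.neg-involutive c))

  negate₂ : ∀ a b c → ℤ.- ((a ℤ.- b) ℤ.+ c) ≡ (b ℤ.- a) ℤ.- c
  negate₂ a b c = trans (ℤ.neg-distrib-+ (a ℤ.- b) c)
    (cong (ℤ._- c) (trans (ℤ.neg-distrib-+ a (ℤ.- b))
      (trans (ℤ.+-comm (ℤ.- a) _) (cong (ℤ._+ ℤ.- a) (ℤ.neg-involutive b)))))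

cyclePower : (n k : ℕ) → Graph n
cyclePower n k = record
  { Adj    = λ i j → i ≢ j × CycleDistance n k i j
  ; adj?   = λ i j → ¬? (i Fin.≟ j) ×-dec
               Fin.any? λ d → (_ ∣? _) ⊎-dec (_ ∣? _)
  ; symm   = λ { {i} {j} (i≢j , d , n∣) →
               ≢-sym i≢j , d , flip (+ toℕ i) (+ toℕ j) (+ suc (toℕ d)) n∣ }
  ; irrefl = λ { (i≢i , _) → i≢i refl }
  }
  where
  flip : ∀ a b c → (+ n ∣ (a ℤ.- b) ℤ.- c) ⊎ (+ n ∣ (a ℤ.- b) ℤ.+ c) →
                   (+ n ∣ (b ℤ.- a) ℤ.- c) ⊎ (+ n ∣ (b ℤ.- a) ℤ.+ c)
  flip a b c (inj₁ x) = inj₂ (subst (+ n ∣_) (negate₁ a b c) (∣m⇒∣-m x))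
  flip a b c (inj₂ x) = inj₁ (subst (+ n ∣_) (negate₂ a b c) (∣m⇒∣-m x))

module _ {n s : ℕ} (G : Graph n) (L : Fin n → Subset s) where

  IsListColouring : (Fin n → Fin s) → Set
  IsListColouring f = (∀ x → f x ∈ L x) × (∀ x y → Adj G x y → f x ≢ f y)

  ListColourable : Set
  ListColourable = ∃ IsListColouring

vectors : ∀ {A : Set} → List A → (n : ℕ) → List (Vec A n)
vectors xs zero    = [] ∷ []
vectors xs (suc n) = cartesianProductWith _∷_ xs (vectors xs n)

∈-vectors⁺ : ∀ {A : Set} {xs : List A} {n} (v : Vec A n) →
             (∀ i → lookup v i ∈ˡ xs) → v ∈ˡ vectors xs n
∈-vectors⁺ []      _ = here refl
∈-vectors⁺ (x ∷ v) h = ∈-cartesianProductWith⁺ _∷_ (h Fin.zero) (∈-vectors⁺ v λ i → h (Fin.suc i))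

∈-vectors⁻ : ∀ {A : Set} {xs : List A} {n} {v : Vec A n} →
             v ∈ˡ vectors xs n → ∀ i → lookup v i ∈ˡ xs
∈-vectors⁻ {xs = xs} {suc n} v∈ i
  with _ , _ , x∈ , w∈ , refl ← ∈-cartesianProductWith⁻ _∷_ xs (vectors xs n) v∈
  with i
... | Fin.zero  = x∈
... | Fin.suc j = ∈-vectors⁻ w∈ j

vectors-unique : ∀ {A : Set} {xs : List A} → Unique xs → ∀ n → Unique (vectors xs n)
vectors-unique u zero    = All.[] AllPairs.∷ AllPairs.[]
vectors-unique u (suc n) = Unique.cartesianProductWith⁺ _∷_ Vec.∷-injective u (vectors-unique u n)

listColourable? : ∀ {n s} (G : Graph n) (L : Fin n → Subset s) → Dec (ListColourable G L)
listColourable? {n} {s} G L = map′ to from (Any.any? dec (vectors (allFin s) n))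
  where
  dec : Decidable (λ (v : Vec (Fin s) n) → IsListColouring G L (lookup v))
  dec v = Fin.all? (λ x → lookup v x ∈? L x) ×-dec
          Fin.all? (λ x → Fin.all? λ y → adj? G x y →-dec ¬? (lookup v x Fin.≟ lookup v y))

  to : Any.Any _ (vectors (allFin s) n) → ListColourable G L
  to a = let v , _ , col = find a in lookup v , col

  from : ListColourable G L → Any.Any _ (vectors (allFin s) n)
  from (f , f∈L , proper) = lose (∈-vectors⁺ (tabulate f) λ i → ∈-allFin _)
    ( (λ x → subst (_∈ L x) (eq x) (f∈L x))
    , (λ x y xy e → proper x y xy (trans (eq x) (trans e (sym (eq y))))) )
    where
    eq : ∀ x → f x ≡ lookup (tabulate f) x
    eq x = sym (Vec.lookup∘tabulate f x)

record UniformSpace (Ω : Set) : Set where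
  field
    outcomes : List Ω
    unique   : Unique outcomes
    nonEmpty : ℕ.NonZero (length outcomes)

ℙ : ∀ {Ω : Set} → UniformSpace Ω → {P : Ω → Set} → Decidable P → ℚ
ℙ U P? = (+ length (filter P? outcomes)) ℚ./ length outcomes
  where
  open UniformSpace U
  instance _ = nonEmpty

subsetsOfSize : (c s : ℕ) → List (Subset s)
subsetsOfSize c s = filter (λ p → ∣ p ∣ ℕ.≟ c) (vectors (inside ∷ outside ∷ []) s)

∈-subsetsOfSize : ∀ {c s} {p : Subset s} → p ∈ˡ subsetsOfSize c s ⇔ ∣ p ∣ ≡ c
∈-subsetsOfSize {c} {s} {p} = mk⇔
  (λ p∈ → proj₂ (∈-filter⁻ (λ p → ∣ p ∣ ℕ.≟ c) {xs = vectors _ s} p∈))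
  (∈-filter⁺ (λ p → ∣ p ∣ ℕ.≟ c) (∈-vectors⁺ p λ i → side∈ (lookup p i)))
  where
  side∈ : ∀ b → b ∈ˡ (inside ∷ outside ∷ [])
  side∈ inside  = here refl
  side∈ outside = there (here refl)

subsetsOfSize-unique : ∀ c s → Unique (subsetsOfSize c s)
subsetsOfSize-unique c s = Unique.filter⁺ (λ p → ∣ p ∣ ℕ.≟ c) (vectors-unique
  (((λ ()) All.∷ All.[]) AllPairs.∷ (All.[] AllPairs.∷ AllPairs.[])) s)

listAssignments : (n c s : ℕ) → List (Vec (Subset s) n)
listAssignments n c s = vectors (subsetsOfSize c s) n

-- Choosing the n lists independently and uniformly among the c-subsets of the
-- colours is the same as choosing the whole assignment uniformly from the product.
randomLists : (n : ℕ) {c s : ℕ} → c ℕ.≤ s → UniformSpace (Vec (Subset s) n)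
randomLists n {c} {s} c≤s = record
  { outcomes = listAssignments n c s
  ; unique   = vectors-unique (subsetsOfSize-unique c s) n
  ; nonEmpty = nonZero (∈-vectors⁺ (Vec.replicate n (proj₁ (some c≤s))) λ i →
      subst (_∈ˡ subsetsOfSize c s) (sym (Vec.lookup-replicate i _))
        (Equivalence.from ∈-subsetsOfSize (proj₂ (some c≤s))))
  }
  where
  nonZero : ∀ {A : Set} {x : A} {xs} → x ∈ˡ xs → ℕ.NonZero (length xs)
  nonZero (here _)  = _
  nonZero (there _) = _

  some : ∀ {c s} → c ℕ.≤ s → Σ (Subset s) λ p → ∣ p ∣ ≡ c
  some {s = zero}  z≤n     = [] , refl
  some {s = suc s} z≤n     = let p , e = some {s = s} z≤n in outside ∷ p , e
  some             (s≤s h) = let p , e = some h in inside ∷ p , cong suc e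

p : (n c k s : ℕ) → c ℕ.≤ s → ℚ
p n c k s c≤s =
  ℙ (randomLists n c≤s) (λ L → listColourable? (cyclePower n k) (lookup L))

fromℕ : ℕ → ℚ
fromℕ m = + m ℚ./ 1

-- x ^ (1 / d) < y for x ≥ 0 and d ≥ 1, without mentioning the possibly irrational root.
_^1/_<_ : ℕ → ℕ → ℚ → Set
x ^1/ d < y = 0ℚ ℚ.≤ y × fromℕ x ℚ.< y ^ d

-- f(n) = ω(n ^ (1 / d)): for every ε > 0, eventually n ^ (1 / d) < ε f(n).
_≫root_ : (ℕ → ℕ) → ℕ → Set
f ≫root d = ∀ ε → 0ℚ ℚ.< ε →
  ∃ λ N → ∀ n → N ℕ.≤ n → n ^1/ d < (ε ℚ.* fromℕ (f n))

_⟶_ : (ℕ → ℚ) → ℚ → Set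
a ⟶ ℓ = ∀ ε → 0ℚ ℚ.< ε → ∃ λ N → ∀ n → N ℕ.≤ n → ℚ.∣ a n ℚ.- ℓ ∣ ℚ.< ε

-- The colours in a window of M = 2kc² consecutive vertices number at most d = cM - c² with
-- probability O(s ^ -c²): such lists are determined by d colours and boundedly much further data.
-- As n s ^ -c² → 0, whp every window carries more than d colours. Then the lists of a window have
-- a system of distinct representatives, because Hall's condition holds for sets of at most c lists
-- by their size, and for larger ones as the whole window has excess below c². Moreover, of the c²
-- disjoint pairs of neighbouring k-blocks of a window one pair has no colour in common. No edge
-- across such a cut is a constraint, so the stretches between the last cuts before each vertex can
-- be coloured independently, each by the representatives of the window starting at its cut.

module Submission where

open import Defs
open import Data.Nat using (ℕ; _≤_; _*_)
open import Data.Rational using (1ℚ)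

open import Algebra.Bundles using (CommutativeRing)
open import Data.Empty using (⊥-elim)
open import Data.Fin as Fin using (Fin; zero; suc; toℕ)
import Data.Fin.Properties as Fin
open import Data.Fin.Subset
open import Data.Fin.Subset.Properties
open import Data.Integer as ℤ using ()
import Data.Integer.Divisibility.Signed as ℤ
import Data.Integer.Properties as ℤ
open import Data.List as List
  using (List; []; _∷_; length; filter; cartesianProduct; cartesianProductWith; concatMap; allFin)
open import Data.List.Properties using (length-++; length-map; length-tabulate)
open import Data.List.Membership.Propositional using (lose) renaming (_∈_ to _∈ˡ_)
open import Data.List.Membership.Propositional.Properties
  using (∈-filter⁺; ∈-filter⁻; ∈-cartesianProductWith⁺; ∈-cartesianProduct⁺; ∈-cartesianProduct⁻;
         ∈-allFin; ∈-concatMap⁺; ∈-lookup)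
import Data.List.Relation.Unary.All as All
import Data.List.Relation.Unary.AllPairs as AllPairs
import Data.List.Relation.Unary.Any as Any
open import Data.List.Relation.Unary.Any using (here; there)
open import Data.List.Relation.Unary.Any.Properties using (lookup-index)
open import Data.List.Relation.Unary.Unique.Propositional using (Unique)
import Data.List.Relation.Unary.Unique.Propositional.Properties as Unique
open import Data.Nat as ℕ using (zero; suc; _+_; _∸_; _^_; _<_; z≤n; s≤s; NonZero)
open import Data.Nat.DivMod
  using (_%_; _/_; _mod_; m%n<n; m<n⇒m%n≡m; [m+kn]%n≡m%n; %-distribˡ-+; m%n%n≡m%n; m≡m%n+[m/n]*n)
open import Data.Nat.Induction using (<-wellFounded)
import Data.Nat.Properties as ℕ
open import Algebra.Properties.CommutativeSemigroup ℕ.+-commutativeSemigroup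
  using () renaming (xy∙z≈xz∙y to +-swap)
open import Data.Nat.Tactic.RingSolver using (solve-∀)
open import Data.Product using (∃; ∃₂; _×_; _,_; proj₁; proj₂)
open import Data.Rational as ℚ using (ℚ; 0ℚ; ↥_; ↧_; ↧ₙ_)
import Data.Rational.Properties as ℚ
import Data.Rational.Unnormalised as ℚᵘ
import Data.Rational.Unnormalised.Properties as ℚᵘ
import Algebra.Properties.CommutativeSemiring.Exp
  (CommutativeRing.commutativeSemiring ℚ.+-*-commutativeRing) as ℚ^
open import Data.Sum using (_⊎_; inj₁; inj₂)
open import Data.Vec as Vec using (Vec; []; _∷_; here; there; lookup; tabulate; replicate)
open import Data.Vec.Functional using (updateAt; foldr)
import Data.Vec.Functional.Properties as Vector
import Data.Vec.Properties as Vec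
open import Function using (_∘_; Equivalence)
open import Function.Definitions using (Injective)
open import Induction.WellFounded using (Acc; acc)
open import Relation.Binary.PropositionalEquality
open import Relation.Nullary using (¬_; yes; no; ¬?)
open import Relation.Unary using (Decidable)

-- Hall's theorem

private variable
  m s : ℕ

∣p∪q∣+∣p∩q∣≡∣p∣+∣q∣ : (p q : Subset s) → ∣ p ∪ q ∣ + ∣ p ∩ q ∣ ≡ ∣ p ∣ + ∣ q ∣
∣p∪q∣+∣p∩q∣≡∣p∣+∣q∣ []            []            = refl
∣p∪q∣+∣p∩q∣≡∣p∣+∣q∣ (inside  ∷ p) (inside  ∷ q) = cong suc (begin
  ∣ p ∪ q ∣ + suc ∣ p ∩ q ∣ ≡⟨ ℕ.+-suc _ _ ⟩
  suc (∣ p ∪ q ∣ + ∣ p ∩ q ∣) ≡⟨ cong suc (∣p∪q∣+∣p∩q∣≡∣p∣+∣q∣ p q) ⟩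
  suc (∣ p ∣ + ∣ q ∣)         ≡⟨ ℕ.+-suc _ _ ⟨
  ∣ p ∣ + suc ∣ q ∣           ∎)
  where open ≡-Reasoning
∣p∪q∣+∣p∩q∣≡∣p∣+∣q∣ (inside  ∷ p) (outside ∷ q) = cong suc (∣p∪q∣+∣p∩q∣≡∣p∣+∣q∣ p q)
∣p∪q∣+∣p∩q∣≡∣p∣+∣q∣ (outside ∷ p) (inside  ∷ q) =
  trans (cong suc (∣p∪q∣+∣p∩q∣≡∣p∣+∣q∣ p q)) (sym (ℕ.+-suc _ _))
∣p∪q∣+∣p∩q∣≡∣p∣+∣q∣ (outside ∷ p) (outside ∷ q) = ∣p∪q∣+∣p∩q∣≡∣p∣+∣q∣ p q

∣p∪q∣≤∣p∣+∣q∣ : (p q : Subset s) → ∣ p ∪ q ∣ ≤ ∣ p ∣ + ∣ q ∣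
∣p∪q∣≤∣p∣+∣q∣ p q = ℕ.≤-trans (ℕ.m≤m+n _ _) (ℕ.≤-reflexive (∣p∪q∣+∣p∩q∣≡∣p∣+∣q∣ p q))

x∈p⇒1≤∣p∣ : {x : Fin s} {p : Subset s} → x ∈ p → 1 ≤ ∣ p ∣
x∈p⇒1≤∣p∣ {x = x} {p} x∈p = subst (_≤ ∣ p ∣) (∣⁅x⁆∣≡1 x)
  (p⊆q⇒∣p∣≤∣q∣ λ y∈ → subst (_∈ p) (sym (x∈⁅y⁆⇒x≡y x y∈)) x∈p)

1≤∣p∣⇒nonempty : (p : Subset s) → 1 ≤ ∣ p ∣ → Nonempty p
1≤∣p∣⇒nonempty {s} p 1≤ with nonempty? p
... | yes ne = ne
... | no ¬ne rewrite Empty-unique ¬ne | ∣⊥∣≡0 s = ⊥-elim (ℕ.1+n≰n 1≤)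

x≢y⇒2≤∣p∣ : {x y : Fin s} {p : Subset s} → x ∈ p → y ∈ p → x ≢ y → 2 ≤ ∣ p ∣
x≢y⇒2≤∣p∣ x∈p y∈p x≢y =
  ℕ.≤-trans (s≤s (x∈p⇒1≤∣p∣ (x∈p∧x≢y⇒x∈p-y y∈p (x≢y ∘ sym)))) (x∈p⇒∣p-x∣<∣p∣ x∈p)

∣p∣≤1+∣p-x∣ : (p : Subset s) (x : Fin s) → ∣ p ∣ ≤ suc ∣ p - x ∣
∣p∣≤1+∣p-x∣ p x = ℕ.≤-trans (p⊆q⇒∣p∣≤∣q∣ split)
  (ℕ.≤-trans (∣p∪q∣≤∣p∣+∣q∣ ⁅ x ⁆ (p - x)) (ℕ.≤-reflexive (cong (_+ ∣ p - x ∣) (∣⁅x⁆∣≡1 x))))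
  where
  split : p ⊆ ⁅ x ⁆ ∪ (p - x)
  split {y} y∈p with y Fin.≟ x
  ... | yes refl = x∈p∪q⁺ (inj₁ (x∈⁅x⁆ x))
  ... | no y≢x   = x∈p∪q⁺ (inj₂ (x∈p∧x≢y⇒x∈p-y y∈p y≢x))

x∉p-x : (p : Subset s) (x : Fin s) → x ∉ p - x
x∉p-x (_ ∷ p) zero    ()
x∉p-x (_ ∷ p) (suc x) (there x∈) = x∉p-x p x x∈

2≤∣p∣⇒∃x≢y : (p : Subset s) → 2 ≤ ∣ p ∣ → ∃₂ λ x y → x ∈ p × y ∈ p × x ≢ y
2≤∣p∣⇒∃x≢y p 2≤ =
  let x , x∈p = 1≤∣p∣⇒nonempty p (ℕ.≤-trans (s≤s z≤n) 2≤)
      y , y∈  = 1≤∣p∣⇒nonempty (p - x) (ℕ.s≤s⁻¹ (ℕ.≤-trans 2≤ (∣p∣≤1+∣p-x∣ p x)))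
  in x , y , x∈p , p─q⊆p p ⁅ x ⁆ y∈ , λ x≡y → x∉p-x p x (subst (_∈ p - x) (sym x≡y) y∈)

⋃[_] : Subset m → (Fin m → Subset s) → Subset s
⋃[ []          ] A = ⊥
⋃[ inside  ∷ J ] A = A zero ∪ ⋃[ J ] (A ∘ suc)
⋃[ outside ∷ J ] A = ⋃[ J ] (A ∘ suc)

∈-⋃⁺ : {J : Subset m} (A : Fin m → Subset s) {i : Fin m} {x : Fin s} →
       i ∈ J → x ∈ A i → x ∈ ⋃[ J ] A
∈-⋃⁺ A here x∈                        = x∈p∪q⁺ (inj₁ x∈)
∈-⋃⁺ {J = inside  ∷ J} A (there i∈) x∈ = x∈p∪q⁺ (inj₂ (∈-⋃⁺ (A ∘ suc) i∈ x∈))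
∈-⋃⁺ {J = outside ∷ J} A (there i∈) x∈ = ∈-⋃⁺ (A ∘ suc) i∈ x∈

∈-⋃⁻ : (J : Subset m) (A : Fin m → Subset s) {x : Fin s} →
       x ∈ ⋃[ J ] A → ∃ λ i → i ∈ J × x ∈ A i
∈-⋃⁻ []            A x∈ = ⊥-elim (∉⊥ x∈)
∈-⋃⁻ (inside  ∷ J) A x∈ with x∈p∪q⁻ (A zero) _ x∈
... | inj₁ x∈A₀ = zero , here , x∈A₀
... | inj₂ x∈⋃  = let i , i∈ , x∈A = ∈-⋃⁻ J (A ∘ suc) x∈⋃ in suc i , there i∈ , x∈A
∈-⋃⁻ (outside ∷ J) A x∈ = let i , i∈ , x∈A = ∈-⋃⁻ J (A ∘ suc) x∈ in suc i , there i∈ , x∈A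

∣⋃∣≤∣J∣*c : ∀ {c} (J : Subset m) (A : Fin m → Subset s) → (∀ i → ∣ A i ∣ ≤ c) →
            ∣ ⋃[ J ] A ∣ ≤ ∣ J ∣ * c
∣⋃∣≤∣J∣*c {s = s} [] A ∣A∣≤c     = ℕ.≤-reflexive (∣⊥∣≡0 s)
∣⋃∣≤∣J∣*c (inside  ∷ J) A ∣A∣≤c = ℕ.≤-trans (∣p∪q∣≤∣p∣+∣q∣ (A zero) _)
  (ℕ.+-mono-≤ (∣A∣≤c zero) (∣⋃∣≤∣J∣*c J (A ∘ suc) (∣A∣≤c ∘ suc)))
∣⋃∣≤∣J∣*c (outside ∷ J) A ∣A∣≤c = ∣⋃∣≤∣J∣*c J (A ∘ suc) (∣A∣≤c ∘ suc)

sum-mono-< : (f g : Fin m → ℕ) → (∀ i → f i ≤ g i) → ∀ j → f j < g j →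
             foldr _+_ 0 f < foldr _+_ 0 g
sum-mono-< f g f≤g zero    fj<gj = ℕ.+-mono-<-≤ fj<gj (sum-mono-≤ (f ∘ suc) (g ∘ suc) (f≤g ∘ suc))
  where
  sum-mono-≤ : ∀ {m} (f g : Fin m → ℕ) → (∀ i → f i ≤ g i) → foldr _+_ 0 f ≤ foldr _+_ 0 g
  sum-mono-≤ {zero}  f g f≤g = z≤n
  sum-mono-≤ {suc m} f g f≤g = ℕ.+-mono-≤ (f≤g zero) (sum-mono-≤ (f ∘ suc) (g ∘ suc) (f≤g ∘ suc))
sum-mono-< f g f≤g (suc j) fj<gj =
  ℕ.+-mono-≤-< (f≤g zero) (sum-mono-< (f ∘ suc) (g ∘ suc) (f≤g ∘ suc) j fj<gj)

HallCondition : (Fin m → Subset s) → Set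
HallCondition A = ∀ J → ∣ J ∣ ≤ ∣ ⋃[ J ] A ∣

-- The finitely many index sets can be searched, so a failure comes with a violating set.
-- `delete-preserves` combines two such sets.
hallCondition? : (A : Fin m → Subset s) →
                 HallCondition A ⊎ ∃ λ J → ∣ ⋃[ J ] A ∣ < ∣ J ∣
hallCondition? A with anySubset? (λ J → ∣ ⋃[ J ] A ∣ ℕ.<? ∣ J ∣)
... | yes v = inj₂ v
... | no ¬v = inj₁ λ J → ℕ.≮⇒≥ λ lt → ¬v (J , lt)

Transversal : (Fin m → Subset s) → Set
Transversal {m} {s} A = ∃ λ (f : Fin m → Fin s) → (∀ i → f i ∈ A i) × Injective _≡_ _≡_ f

delete : (Fin m → Subset s) → Fin m → Fin s → Fin m → Subset s
delete A i x = updateAt A i (_- x)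

module _ (A : Fin m → Subset s) (i : Fin m) (x : Fin s) where

  delete-at : ∀ {z} → z ∈ A i → z ≢ x → z ∈ delete A i x i
  delete-at z∈ z≢x = subst (_ ∈_) (sym (Vector.updateAt-updates i A)) (x∈p∧x≢y⇒x∈p-y z∈ z≢x)

  delete-off : ∀ {j} → j ≢ i → delete A i x j ≡ A j
  delete-off j≢i = Vector.updateAt-minimal _ i A j≢i

  delete-⊆ : ∀ j → delete A i x j ⊆ A j
  delete-⊆ j z∈ with j Fin.≟ i
  ... | yes refl = p─q⊆p (A i) ⁅ x ⁆ (subst (_ ∈_) (Vector.updateAt-updates i A) z∈)
  ... | no j≢i   = subst (_ ∈_) (delete-off j≢i) z∈

  delete-shrinks : x ∈ A i →
    foldr _+_ 0 (λ j → ∣ delete A i x j ∣) < foldr _+_ 0 (λ j → ∣ A j ∣)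
  delete-shrinks x∈ = sum-mono-< _ _ (λ j → p⊆q⇒∣p∣≤∣q∣ (delete-⊆ j)) i
    (subst (λ p → ∣ p ∣ < ∣ A i ∣) (sym (Vector.updateAt-updates i A)) (x∈p⇒∣p-x∣<∣p∣ x∈))

  -- The deletion alters only the list at `i`, so for an index set without `i` the condition on `A`
  -- applies as it stands.
  deficient-contains : HallCondition A → ∀ J → ∣ ⋃[ J ] (delete A i x) ∣ < ∣ J ∣ → i ∈ J
  deficient-contains hall J def with i ∈? J
  ... | yes i∈J = i∈J
  ... | no i∉J  = ⊥-elim (ℕ.<⇒≱ def (ℕ.≤-trans (hall J) (p⊆q⇒∣p∣≤∣q∣ λ z∈ →
    let j , j∈J , z∈Aj = ∈-⋃⁻ J A z∈ in
    ∈-⋃⁺ (delete A i x) j∈J (subst (_ ∈_) (sym (delete-off λ j≡i → i∉J (subst (_∈ J) j≡i j∈J))) z∈Aj))))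

-- If J and K were deficient after deleting x resp. y, submodularity of J ↦ ∣ ⋃[ J ] A ∣
-- would make J ∪ K or (J ∩ K) - i deficient for A.
delete-preserves : (A : Fin m → Subset s) → HallCondition A → ∀ i {x y} → x ≢ y →
  HallCondition (delete A i x) ⊎ HallCondition (delete A i y)
delete-preserves A hall i {x} {y} x≢y with hallCondition? (delete A i x) | hallCondition? (delete A i y)
... | inj₁ h | _      = inj₁ h
... | inj₂ _ | inj₁ h = inj₂ h
... | inj₂ (J , defJ) | inj₂ (K , defK) = ⊥-elim (ℕ.<⇒≱ (ℕ.+-mono-≤ defJ defK) (begin
  ∣ J ∣ + ∣ K ∣                                ≡⟨ ∣p∪q∣+∣p∩q∣≡∣p∣+∣q∣ J K ⟨
  -- Dropping `i`, the only index whose list was altered, costs one, which is less than the combined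
  -- deficiency of at least two of `J` and `K`.
  ∣ J ∪ K ∣ + ∣ J ∩ K ∣                        ≤⟨ ℕ.+-mono-≤ (hall (J ∪ K)) (∣p∣≤1+∣p-x∣ (J ∩ K) i) ⟩
  ∣ ⋃[ J ∪ K ] A ∣ + suc ∣ J ∩ K - i ∣         ≤⟨ ℕ.+-monoʳ-≤ _ (s≤s (hall (J ∩ K - i))) ⟩
  ∣ ⋃[ J ∪ K ] A ∣ + suc ∣ ⋃[ J ∩ K - i ] A ∣  ≤⟨ ℕ.+-mono-≤ (p⊆q⇒∣p∣≤∣q∣ sub∪) (s≤s (p⊆q⇒∣p∣≤∣q∣ sub∩)) ⟩
  ∣ P ∪ Q ∣ + suc ∣ P ∩ Q ∣                    ≡⟨ ℕ.+-suc _ _ ⟩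
  suc (∣ P ∪ Q ∣ + ∣ P ∩ Q ∣)                  ≡⟨ cong suc (∣p∪q∣+∣p∩q∣≡∣p∣+∣q∣ P Q) ⟩
  suc (∣ P ∣ + ∣ Q ∣)                          ≤⟨ ℕ.≤-reflexive (sym (ℕ.+-suc _ _)) ⟩
  ∣ P ∣ + suc ∣ Q ∣                            ∎))
  where
  open ℕ.≤-Reasoning
  P = ⋃[ J ] (delete A i x)
  Q = ⋃[ K ] (delete A i y)
  i∈J = deficient-contains A i x hall J defJ
  i∈K = deficient-contains A i y hall K defK

  -- A colour of `A i` differs from `x` or from `y`, so one of the two deletions keeps it, and `i`
  -- lies in both `J` and `K`.
  sub∪ : ⋃[ J ∪ K ] A ⊆ P ∪ Q
  sub∪ {z} z∈ with ∈-⋃⁻ (J ∪ K) A z∈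
  ... | j , j∈ , z∈Aj with j Fin.≟ i
  ...   | no j≢i with x∈p∪q⁻ J K j∈
  ...     | inj₁ j∈J = x∈p∪q⁺ (inj₁ (∈-⋃⁺ (delete A i x) j∈J (subst (z ∈_) (sym (delete-off A i x j≢i)) z∈Aj)))
  ...     | inj₂ j∈K = x∈p∪q⁺ (inj₂ (∈-⋃⁺ (delete A i y) j∈K (subst (z ∈_) (sym (delete-off A i y j≢i)) z∈Aj)))
  sub∪ {z} z∈ | j , j∈ , z∈Aj | yes refl with z Fin.≟ x
  ...   | no z≢x   = x∈p∪q⁺ (inj₁ (∈-⋃⁺ (delete A i x) i∈J (delete-at A i x z∈Aj z≢x)))
  ...   | yes refl = x∈p∪q⁺ (inj₂ (∈-⋃⁺ (delete A i y) i∈K (delete-at A i y z∈Aj x≢y)))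

  sub∩ : ⋃[ J ∩ K - i ] A ⊆ P ∩ Q
  sub∩ {z} z∈ =
    let j , j∈ , z∈Aj = ∈-⋃⁻ (J ∩ K - i) A z∈
        j∈J , j∈K     = x∈p∩q⁻ J K (p─q⊆p (J ∩ K) ⁅ i ⁆ j∈)
        j≢i : j ≢ i
        j≢i = λ j≡i → x∉p-x (J ∩ K) i (subst (_∈ J ∩ K - i) j≡i j∈)
    in x∈p∩q⁺ ( ∈-⋃⁺ (delete A i x) j∈J (subst (z ∈_) (sym (delete-off A i x j≢i)) z∈Aj)
              , ∈-⋃⁺ (delete A i y) j∈K (subst (z ∈_) (sym (delete-off A i y j≢i)) z∈Aj) )

transversal-mono : {A B : Fin m → Subset s} → (∀ i → A i ⊆ B i) → Transversal A → Transversal B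
transversal-mono A⊆B (f , f∈ , inj) = f , (λ i → A⊆B i (f∈ i)) , inj

-- The end of the deletion process: Hall's condition for one index makes each list a singleton, and
-- for two indices it makes the singletons distinct.
hall-singletons : (A : Fin m → Subset s) → HallCondition A → (∀ i → ∣ A i ∣ ≤ 1) → Transversal A
hall-singletons {m} {s} A hall ∣A∣≤1 = f , f∈ , inj
  where
  nonempty : ∀ i → Nonempty (A i)
  nonempty i = let x , x∈ = 1≤∣p∣⇒nonempty (⋃[ ⁅ i ⁆ ] A) (subst (_≤ ∣ ⋃[ ⁅ i ⁆ ] A ∣) (∣⁅x⁆∣≡1 i) (hall ⁅ i ⁆))
                   j , j∈ , x∈A = ∈-⋃⁻ ⁅ i ⁆ A x∈
               in x , subst (λ j → x ∈ A j) (x∈⁅y⁆⇒x≡y i j∈) x∈A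
  f : Fin m → Fin s
  f i = proj₁ (nonempty i)
  f∈ : ∀ i → f i ∈ A i
  f∈ i = proj₂ (nonempty i)
  only : ∀ i {z} → z ∈ A i → z ≡ f i
  only i {z} z∈ with z Fin.≟ f i
  ... | yes z≡ = z≡
  ... | no z≢  = ⊥-elim (ℕ.<⇒≱ (x≢y⇒2≤∣p∣ z∈ (f∈ i) z≢) (∣A∣≤1 i))
  inj : Injective _≡_ _≡_ f
  inj {i} {j} fi≡fj with i Fin.≟ j
  ... | yes i≡j = i≡j
  ... | no i≢j  = ⊥-elim (ℕ.1+n≰n (begin
    2                         ≤⟨ x≢y⇒2≤∣p∣ (x∈p∪q⁺ (inj₁ (x∈⁅x⁆ i))) (x∈p∪q⁺ (inj₂ (x∈⁅x⁆ j))) i≢j ⟩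
    ∣ ⁅ i ⁆ ∪ ⁅ j ⁆ ∣         ≤⟨ hall (⁅ i ⁆ ∪ ⁅ j ⁆) ⟩
    ∣ ⋃[ ⁅ i ⁆ ∪ ⁅ j ⁆ ] A ∣  ≤⟨ p⊆q⇒∣p∣≤∣q∣ sub ⟩
    ∣ ⁅ f i ⁆ ∣               ≡⟨ ∣⁅x⁆∣≡1 (f i) ⟩
    1                         ∎))
    where
    open ℕ.≤-Reasoning
    sub : ⋃[ ⁅ i ⁆ ∪ ⁅ j ⁆ ] A ⊆ ⁅ f i ⁆
    sub {z} z∈ with ∈-⋃⁻ (⁅ i ⁆ ∪ ⁅ j ⁆) A z∈
    ... | l , l∈ , z∈Al with x∈p∪q⁻ ⁅ i ⁆ ⁅ j ⁆ l∈
    ...   | inj₁ l∈i rewrite x∈⁅y⁆⇒x≡y i l∈i | only i z∈Al = x∈⁅x⁆ (f i)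
    ...   | inj₂ l∈j rewrite x∈⁅y⁆⇒x≡y j l∈j | only j z∈Al | fi≡fj = x∈⁅x⁆ (f j)

-- Rado's argument: from a list with two colours, one of them can be deleted without breaking Hall's
-- condition. The total size of the lists drops each time, so the recursion ends with lists of at
-- most one colour.
hall⇒transversal : (A : Fin m → Subset s) → HallCondition A → Transversal A
hall⇒transversal A hall = go A hall (<-wellFounded _)
  where
  go : (A : Fin m → Subset s) → HallCondition A → Acc _<_ (foldr _+_ 0 (λ i → ∣ A i ∣)) → Transversal A
  go A hall (acc rec) with Fin.any? (λ i → 2 ℕ.≤? ∣ A i ∣)
  ... | no none = hall-singletons A hall λ i → ℕ.s≤s⁻¹ (ℕ.≰⇒> λ 2≤ → none (i , 2≤))
  ... | yes (i , 2≤) with 2≤∣p∣⇒∃x≢y (A i) 2≤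
  ...   | x , y , x∈ , y∈ , x≢y with delete-preserves A hall i x≢y
  ...     | inj₁ h = transversal-mono (delete-⊆ A i x) (go (delete A i x) h (rec (delete-shrinks A i x x∈)))
  ...     | inj₂ h = transversal-mono (delete-⊆ A i y) (go (delete A i y) h (rec (delete-shrinks A i y y∈)))

-- Cutting and colouring the cycle

greatest-below : {P : ℕ → Set} → Decidable P → ∀ N {u} → u ≤ N → P u →
  ∃ λ v → u ≤ v × v ≤ N × P v × (∀ w → v < w → w ≤ N → ¬ P w)
greatest-below P? N u≤N Pu with P? N
... | yes PN = N , u≤N , ℕ.≤-refl , PN , λ w N<w w≤N → ⊥-elim (ℕ.<⇒≱ N<w w≤N)
greatest-below P? zero    z≤n Pu | no ¬PN = ⊥-elim (¬PN Pu)
greatest-below {P} P? (suc N) u≤N Pu | no ¬PN =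
  let v , u≤v , v≤N , Pv , max = greatest-below P? N (below u≤N Pu) Pu
  in v , u≤v , ℕ.m≤n⇒m≤1+n v≤N , Pv , λ w v<w w≤1+N Pw → max w v<w (below w≤1+N Pw) Pw
  where
  below : ∀ {w} → w ≤ suc N → P w → w ≤ N
  below w≤1+N Pw = ℕ.s≤s⁻¹ (ℕ.≤∧≢⇒< w≤1+N λ { refl → ¬PN Pw })

module _ {n : ℕ} .{{_ : NonZero n}} where

  open import Data.Integer using (+_; -[1+_])

  window : ∀ {M} → Fin n → Fin M → Fin n
  window t i = (toℕ t + toℕ i) mod n

  toℕ-mod : ∀ x → toℕ (x mod n) ≡ x % n
  toℕ-mod x = Fin.toℕ-fromℕ< (m%n<n x n)

  mod-cong : ∀ {x y} → x % n ≡ y % n → x mod n ≡ y mod n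
  mod-cong {x} {y} eq = Fin.toℕ-injective (trans (toℕ-mod x) (trans eq (sym (toℕ-mod y))))

  mod-periodic : ∀ x a → (x + a * n) mod n ≡ x mod n
  mod-periodic x a = mod-cong ([m+kn]%n≡m%n x a n)

  toℕ-mod-id : ∀ (i : Fin n) → toℕ i mod n ≡ i
  toℕ-mod-id i = Fin.toℕ-injective (trans (toℕ-mod (toℕ i)) (m<n⇒m%n≡m (Fin.toℕ<n i)))

  window-mod : ∀ {M} x (i : Fin M) → window (x mod n) i ≡ (x + toℕ i) mod n
  window-mod x i = mod-cong (begin
    (toℕ (x mod n) + toℕ i) % n    ≡⟨ cong (λ y → (y + toℕ i) % n) (toℕ-mod x) ⟩
    (x % n + toℕ i) % n            ≡⟨ %-distribˡ-+ (x % n) (toℕ i) n ⟩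
    (x % n % n + toℕ i % n) % n    ≡⟨ cong (λ y → (y + toℕ i % n) % n) (m%n%n≡m%n x n) ⟩
    (x % n + toℕ i % n) % n        ≡⟨ %-distribˡ-+ x (toℕ i) n ⟨
    (x + toℕ i) % n                ∎)
    where open ≡-Reasoning

  -- The sign of the quotient decides which side receives the multiple of `n`; the congruence thus
  -- becomes an equation without subtraction.
  ∣-difference : ∀ {A B} → + n ℤ.∣ (+ A ℤ.- + B) → ∃₂ λ a b → A + a * n ≡ B + b * n
  ∣-difference {A} {B} (ℤ.divides q eq) = go q eq
    where
    A≡ : ∀ q → + A ℤ.- + B ≡ q ℤ.* + n → + A ≡ q ℤ.* + n ℤ.+ + B
    A≡ q eq = trans (sym (trans (ℤ.+-assoc (+ A) (ℤ.- + B) (+ B))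
      (trans (cong (ℤ._+_ (+ A)) (ℤ.+-inverseˡ (+ B))) (ℤ.+-identityʳ (+ A))))) (cong (ℤ._+ + B) eq)
    go : ∀ q → + A ℤ.- + B ≡ q ℤ.* + n → ∃₂ λ a b → A + a * n ≡ B + b * n
    go (+ b) eq = 0 , b , trans (ℕ.+-identityʳ A) (ℤ.+-injective (trans (A≡ (+ b) eq)
      (trans (cong (ℤ._+ + B) (sym (ℤ.pos-* b n))) (ℤ.+-comm (+ (b * n)) (+ B)))))
    go -[1+ a ] eq = suc a , 0 , trans (ℤ.+-injective (begin
      + A ℤ.+ + (suc a * n)                          ≡⟨ cong (ℤ._+ + (suc a * n)) (A≡ -[1+ a ] eq) ⟩
      -[1+ a ] ℤ.* + n ℤ.+ + B ℤ.+ + (suc a * n)     ≡⟨ cong (λ z → z ℤ.+ + B ℤ.+ + (suc a * n)) neg ⟩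
      ℤ.- + (suc a * n) ℤ.+ + B ℤ.+ + (suc a * n)    ≡⟨ cong (ℤ._+ + (suc a * n)) (ℤ.+-comm (ℤ.- + (suc a * n)) (+ B)) ⟩
      + B ℤ.+ ℤ.- + (suc a * n) ℤ.+ + (suc a * n)    ≡⟨ ℤ.+-assoc (+ B) (ℤ.- + (suc a * n)) (+ (suc a * n)) ⟩
      + B ℤ.+ (ℤ.- + (suc a * n) ℤ.+ + (suc a * n))  ≡⟨ cong (ℤ._+_ (+ B)) (ℤ.+-inverseˡ (+ (suc a * n))) ⟩
      + B ℤ.+ + 0                                    ≡⟨ ℤ.+-identityʳ (+ B) ⟩
      + B                                            ∎)) (sym (ℕ.+-identityʳ B))
      where
      open ≡-Reasoning
      neg : -[1+ a ] ℤ.* + n ≡ ℤ.- + (suc a * n)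
      neg = trans (sym (ℤ.neg-distribˡ-* (+ suc a) (+ n))) (cong ℤ.-_ (sym (ℤ.pos-* (suc a) n)))

  -- Unrolls the cycle onto the line: adjacent vertices have lifts exactly `e` apart, and the
  -- disjunction tells which of the two lies to the right.
  neighbour-offset : ∀ {k} (i j : Fin n) → CycleDistance n k i j →
    ∃ λ e → 1 ≤ e × e ≤ k × ∃₂ λ a b →
      (toℕ i + a * n ≡ toℕ j + e + b * n) ⊎ (toℕ j + a * n ≡ toℕ i + e + b * n)
  neighbour-offset i j (d , inj₁ n∣) =
    let a , b , eq = ∣-difference {toℕ i} {toℕ j + suc (toℕ d)} (subst (+ n ℤ.∣_) shape n∣)
    in suc (toℕ d) , s≤s z≤n , Fin.toℕ<n d , a , b , inj₁ eq
    where
    shape : (+ toℕ i ℤ.- + toℕ j) ℤ.- + suc (toℕ d) ≡ + toℕ i ℤ.- + (toℕ j + suc (toℕ d))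
    shape = trans (ℤ.+-assoc (+ toℕ i) (ℤ.- + toℕ j) _)
      (cong (ℤ._+_ (+ toℕ i)) (sym (ℤ.neg-distrib-+ (+ toℕ j) (+ suc (toℕ d)))))
  neighbour-offset i j (d , inj₂ n∣) =
    let a , b , eq = ∣-difference {toℕ i + suc (toℕ d)} {toℕ j} (subst (+ n ℤ.∣_) shape n∣)
    in suc (toℕ d) , s≤s z≤n , Fin.toℕ<n d , b , a , inj₂ (sym eq)
    where
    shape : (+ toℕ i ℤ.- + toℕ j) ℤ.+ + suc (toℕ d) ≡ + (toℕ i + suc (toℕ d)) ℤ.- + toℕ j
    shape = trans (ℤ.+-assoc (+ toℕ i) (ℤ.- + toℕ j) _)
      (trans (cong (ℤ._+_ (+ toℕ i)) (ℤ.+-comm (ℤ.- + toℕ j) (+ suc (toℕ d))))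
        (sym (ℤ.+-assoc (+ toℕ i) (+ suc (toℕ d)) (ℤ.- + toℕ j))))

-- For at most `c` indices a single list is large enough. In general the lists outside `J` add at
-- most `c` colours each, so more than `c∣J∣ - c²` colours remain for `J`. When `∣J∣ > c` this gives
-- at least `∣J∣`, because `(c - 1)(∣J∣ - c - 1)` is not negative.
small-excess⇒hall : ∀ {m s c d} (A : Fin m → Subset s) → 1 ≤ c → (∀ i → ∣ A i ∣ ≡ c) →
  d + c * c ≡ c * m → d < ∣ ⋃[ ⊤ ] A ∣ → HallCondition A
small-excess⇒hall {m} {s} {c} {d} A 1≤c ∣A∣≡c d+c² d<⋃ J = compare c 1≤c lists excess
  where
  open ℕ.≤-Reasoning
  lists : 1 ≤ ∣ J ∣ → c ≤ ∣ ⋃[ J ] A ∣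
  lists 1≤J = let i , i∈J = 1≤∣p∣⇒nonempty J 1≤J in
    subst (_≤ ∣ ⋃[ J ] A ∣) (∣A∣≡c i) (p⊆q⇒∣p∣≤∣q∣ (∈-⋃⁺ A i∈J))

  cover : ⋃[ ⊤ ] A ⊆ ⋃[ J ] A ∪ ⋃[ ∁ J ] A
  cover x∈ with ∈-⋃⁻ ⊤ A x∈
  ... | i , _ , x∈A with i ∈? J
  ...   | yes i∈J = x∈p∪q⁺ (inj₁ (∈-⋃⁺ A i∈J x∈A))
  ...   | no  i∉J = x∈p∪q⁺ (inj₂ (∈-⋃⁺ A (x∉p⇒x∈∁p i∉J) x∈A))

  ∣J∣+∣∁J∣ : ∣ J ∣ + ∣ ∁ J ∣ ≡ m
  ∣J∣+∣∁J∣ = trans (cong (ℕ._+_ ∣ J ∣) (∣∁p∣≡n∸∣p∣ J)) (ℕ.m+[n∸m]≡n (∣p∣≤n J))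

  excess : suc (c * ∣ J ∣) ≤ ∣ ⋃[ J ] A ∣ + c * c
  excess = ℕ.+-cancelʳ-≤ (∣ ∁ J ∣ * c) _ _ (begin
    suc (c * ∣ J ∣) + ∣ ∁ J ∣ * c              ≡⟨ cong suc (cong (ℕ._+_ (c * ∣ J ∣)) (ℕ.*-comm ∣ ∁ J ∣ c)) ⟩
    suc (c * ∣ J ∣ + c * ∣ ∁ J ∣)              ≡⟨ cong suc (ℕ.*-distribˡ-+ c ∣ J ∣ ∣ ∁ J ∣) ⟨
    suc (c * (∣ J ∣ + ∣ ∁ J ∣))                ≡⟨ cong (λ z → suc (c * z)) ∣J∣+∣∁J∣ ⟩
    suc (c * m)                                ≡⟨ cong suc d+c² ⟨
    suc d + c * c                              ≤⟨ ℕ.+-monoˡ-≤ (c * c) d<⋃ ⟩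
    ∣ ⋃[ ⊤ ] A ∣ + c * c                       ≤⟨ ℕ.+-monoˡ-≤ (c * c) (p⊆q⇒∣p∣≤∣q∣ cover) ⟩
    ∣ ⋃[ J ] A ∪ ⋃[ ∁ J ] A ∣ + c * c          ≤⟨ ℕ.+-monoˡ-≤ (c * c) (∣p∪q∣≤∣p∣+∣q∣ (⋃[ J ] A) (⋃[ ∁ J ] A)) ⟩
    ∣ ⋃[ J ] A ∣ + ∣ ⋃[ ∁ J ] A ∣ + c * c      ≤⟨ ℕ.+-monoˡ-≤ (c * c) (ℕ.+-monoʳ-≤ ∣ ⋃[ J ] A ∣
                                                    (∣⋃∣≤∣J∣*c (∁ J) A (ℕ.≤-reflexive ∘ ∣A∣≡c))) ⟩
    ∣ ⋃[ J ] A ∣ + ∣ ∁ J ∣ * c + c * c         ≡⟨ +-swap ∣ ⋃[ J ] A ∣ (∣ ∁ J ∣ * c) (c * c) ⟩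
    ∣ ⋃[ J ] A ∣ + c * c + ∣ ∁ J ∣ * c         ∎)

  compare : ∀ {j u} c → 1 ≤ c → (1 ≤ j → c ≤ u) → suc (c * j) ≤ u + c * c → j ≤ u
  compare {zero}  c _ _ _ = z≤n
  compare {suc j} {u} c 1≤c c≤u cj<u+c² with suc j ℕ.≤? c
  ... | yes j≤c = ℕ.≤-trans j≤c (c≤u (s≤s z≤n))
  compare {suc j} {u} (suc c) _ _ cj<u+c² | no j≰c with ℕ.m≤n⇒∃[o]m+o≡n (ℕ.≰⇒> j≰c)
  -- With `suc c` for the list size and `2 + c + t` for the number of indices, the product above is
  -- the slack `c * t`.
  ... | t , refl = ℕ.+-cancelʳ-≤ (suc c * suc c) _ _ (begin
    2 + c + t + suc c * suc c                ≤⟨ ℕ.m≤m+n _ (c * t) ⟩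
    2 + c + t + suc c * suc c + c * t        ≡⟨ expand c t ⟩
    suc (suc c * (2 + c + t))                ≤⟨ cj<u+c² ⟩
    u + suc c * suc c                        ∎)
    where
    expand : ∀ c t → 2 + c + t + suc c * suc c + c * t ≡ suc (suc c * (2 + c + t))
    expand = solve-∀

-- Colouring the cycle power when every window carries many colours

module CutAndColour {n s c k M d : ℕ} .{{_ : NonZero n}} (1≤c : 1 ≤ c) (1≤k : 1 ≤ k)
  (M≡ : M ≡ c * c * (k + k)) (d+c² : d + c * c ≡ c * M) (M≤n : M ≤ n)
  (L : Fin n → Subset s) (∣L∣≡c : ∀ i → ∣ L i ∣ ≡ c)
  (spread : ∀ (t : Fin n) → d < ∣ ⋃[ ⊤ ] (λ (i : Fin M) → L (window t i)) ∣) where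

  -- Positions are natural numbers, covering the cycle periodically, so that cuts are ordered and
  -- comparisons need no wrap-around.
  list : ℕ → Subset s
  list x = L (x mod n)

  list-periodic : ∀ x a → list (x + a * n) ≡ list x
  list-periodic x a = cong L (mod-periodic x a)

  span : ℕ → ℕ → Subset s
  span t zero    = ⊥
  span t (suc m) = list t ∪ span (suc t) m

  ∈-span⁺ : ∀ {t m i x} → i < m → x ∈ list (t + i) → x ∈ span t m
  ∈-span⁺ {t} {suc m} {zero}  {x} _         x∈ = x∈p∪q⁺ (inj₁ (subst (λ y → x ∈ list y) (ℕ.+-identityʳ t) x∈))
  ∈-span⁺ {t} {suc m} {suc i} {x} (s≤s i<m) x∈ =
    x∈p∪q⁺ (inj₂ (∈-span⁺ i<m (subst (λ y → x ∈ list y) (ℕ.+-suc t i) x∈)))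

  ∣span∣≤ : ∀ t m → ∣ span t m ∣ ≤ m * c
  ∣span∣≤ t zero    = ℕ.≤-reflexive (∣⊥∣≡0 s)
  ∣span∣≤ t (suc m) = ℕ.≤-trans (∣p∪q∣≤∣p∣+∣q∣ (list t) _)
    (ℕ.+-mono-≤ (ℕ.≤-reflexive (∣L∣≡c (t mod n))) (∣span∣≤ (suc t) m))

  span-+ : ∀ t m m′ → span t (m + m′) ≡ span t m ∪ span (t + m) m′
  span-+ t zero    m′ = trans (cong (λ t → span t m′) (sym (ℕ.+-identityʳ t))) (sym (∪-identityˡ _))
  span-+ t (suc m) m′ = trans (cong (list t ∪_) (trans (span-+ (suc t) m m′)
      (cong (λ u → span (suc t) m ∪ span u m′) (sym (ℕ.+-suc t m)))))
    (sym (∪-assoc (list t) (span (suc t) m) (span (t + suc m) m′)))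

  span-periodic : ∀ t a m → span (t + a * n) m ≡ span t m
  span-periodic t a zero    = refl
  span-periodic t a (suc m) = cong₂ _∪_ (list-periodic t a) (span-periodic (suc t) a m)

  -- No edge of the cycle power crossing position u + k constrains a colouring.
  Cut : ℕ → Set
  Cut u = Empty (span u k ∩ span (u + k) k)

  cut? : Decidable Cut
  cut? u = ¬? (nonempty? _)

  cut-periodic : ∀ u a → Cut (u + a * n) ≡ Cut u
  cut-periodic u a = cong₂ (λ p q → Empty (p ∩ q)) (span-periodic u a k)
    (trans (cong (λ v → span v k) (+-swap u (a * n) k)) (span-periodic (u + k) a k))

  -- A colour common to both blocks is counted twice in the sum of their sizes, so the `k + k` lists
  -- together miss their maximum by at least one.
  ¬cut⇒repeat : ∀ u → ¬ Cut u → suc ∣ span u (k + k) ∣ ≤ (k + k) * c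
  ¬cut⇒repeat u ¬cut with nonempty? (span u k ∩ span (u + k) k)
  ... | no empty = ⊥-elim (¬cut empty)
  ... | yes (x , x∈) = begin
    suc ∣ span u (k + k) ∣       ≡⟨ cong (λ p → suc ∣ p ∣) (span-+ u k k) ⟩
    suc ∣ P ∪ Q ∣                ≡⟨ ℕ.+-comm 1 ∣ P ∪ Q ∣ ⟩
    ∣ P ∪ Q ∣ + 1                ≤⟨ ℕ.+-monoʳ-≤ ∣ P ∪ Q ∣ (x∈p⇒1≤∣p∣ x∈) ⟩
    ∣ P ∪ Q ∣ + ∣ P ∩ Q ∣        ≡⟨ ∣p∪q∣+∣p∩q∣≡∣p∣+∣q∣ P Q ⟩
    ∣ P ∣ + ∣ Q ∣                ≤⟨ ℕ.+-mono-≤ (∣span∣≤ u k) (∣span∣≤ (u + k) k) ⟩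
    k * c + k * c                ≡⟨ ℕ.*-distribʳ-+ c k k ⟨
    (k + k) * c                  ∎
    where
    open ℕ.≤-Reasoning
    P = span u k
    Q = span (u + k) k

  -- The stretch falls into `r` disjoint pairs of `k`-blocks. Each pair that is not a cut wastes a
  -- colour, and the waste adds up.
  cut-or-repeats : ∀ r t →
    (∃ λ u → t ≤ u × u + (k + k) ≤ t + r * (k + k) × Cut u) ⊎
    r + ∣ span t (r * (k + k)) ∣ ≤ r * ((k + k) * c)
  cut-or-repeats zero t = inj₂ (ℕ.≤-reflexive (∣⊥∣≡0 s))
  cut-or-repeats (suc r) t with cut? t
  ... | yes cut = inj₁ (t , ℕ.≤-refl , ℕ.+-monoʳ-≤ t (ℕ.m≤m+n (k + k) _) , cut)
  ... | no ¬cut with cut-or-repeats r (t + (k + k))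
  ...   | inj₁ (u , t≤u , u≤ , cut) = inj₁ (u , ℕ.≤-trans (ℕ.m≤m+n t (k + k)) t≤u ,
            ℕ.≤-trans u≤ (ℕ.≤-reflexive (ℕ.+-assoc t (k + k) (r * (k + k)))) , cut)
  ...   | inj₂ few = inj₂ (begin
    suc r + ∣ span t (k + k + r * (k + k)) ∣      ≡⟨ cong (λ p → suc r + ∣ p ∣) (span-+ t (k + k) (r * (k + k))) ⟩
    suc r + ∣ P ∪ Q ∣                             ≤⟨ ℕ.+-monoʳ-≤ (suc r) (∣p∪q∣≤∣p∣+∣q∣ P Q) ⟩
    suc r + (∣ P ∣ + ∣ Q ∣)                       ≡⟨ regroup r ∣ P ∣ ∣ Q ∣ ⟩
    suc ∣ P ∣ + (r + ∣ Q ∣)                       ≤⟨ ℕ.+-mono-≤ (¬cut⇒repeat t ¬cut) few ⟩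
    (k + k) * c + r * ((k + k) * c)               ∎)
    where
    open ℕ.≤-Reasoning
    P = span t (k + k)
    Q = span (t + (k + k)) (r * (k + k))
    regroup : ∀ r p q → suc r + (p + q) ≡ suc p + (r + q)
    regroup = solve-∀

  d<∣span∣ : ∀ t → d < ∣ span t M ∣
  d<∣span∣ t = ℕ.≤-trans (spread (t mod n)) (p⊆q⇒∣p∣≤∣q∣ sub)
    where
    sub : ⋃[ ⊤ ] (λ (i : Fin M) → L (window (t mod n) i)) ⊆ span t M
    sub x∈ = let i , _ , x∈L = ∈-⋃⁻ ⊤ (λ (i : Fin M) → L (window (t mod n) i)) x∈ in
      ∈-span⁺ (Fin.toℕ<n i) (subst (λ j → _ ∈ L j) (window-mod t i) x∈L)

  -- Without a cut, the `c * c` pairs of blocks in a window would waste `c * c` colours and leave at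
  -- most `d`, against `spread`.
  cut-exists : ∀ t → ∃ λ u → t ≤ u × u + (k + k) ≤ t + M × Cut u
  cut-exists t with cut-or-repeats (c * c) t
  ... | inj₁ found = subst (λ M → ∃ λ u → t ≤ u × u + (k + k) ≤ t + M × Cut u) (sym M≡) found
  ... | inj₂ few   = ⊥-elim (ℕ.<⇒≱ (d<∣span∣ t) (ℕ.+-cancelˡ-≤ (c * c) _ _ (begin
    c * c + ∣ span t M ∣                  ≡⟨ cong (λ M → c * c + ∣ span t M ∣) M≡ ⟩
    c * c + ∣ span t (c * c * (k + k)) ∣  ≤⟨ few ⟩
    c * c * ((k + k) * c)                 ≡⟨ regroup (c * c) (k + k) c ⟩
    c * (c * c * (k + k))                 ≡⟨ cong (c *_) M≡ ⟨
    c * M                                 ≡⟨ d+c² ⟨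
    d + c * c                             ≡⟨ ℕ.+-comm d (c * c) ⟩
    c * c + d                             ∎)))
    where
    open ℕ.≤-Reasoning
    regroup : ∀ x y z → x * (y * z) ≡ z * (x * y)
    regroup = solve-∀

  -- The stretch of `x` begins at `u + k`, the middle of the cut, and `offset` is the index of `x`
  -- in the window starting there. Accordingly `last` ranges over all cuts whose middle is at most
  -- `x`.
  record LastCut (x : ℕ) : Set where
    field
      u        : ℕ
      offset   : Fin M
      position : u + k + toℕ offset ≡ x
      cut      : Cut u
      last     : ∀ v → u < v → v + k ≤ x → ¬ Cut v

  abstract
    -- Searching from `x ∸ M` yields some cut with its middle at most `x`. The last such cut is no
    -- earlier, so `x` is at most `M` beyond `u`; as the middle is `k ≥ 1` further on, the offset is
    -- below `M`.
    lastCut : ∀ x → M ≤ x → LastCut x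
    lastCut x M≤x =
      let t = x ∸ M
          t+M≡x : t + M ≡ x
          t+M≡x = ℕ.m∸n+n≡m M≤x
          u₀ , t≤u₀ , u₀≤ , cut₀ = cut-exists t
          u₀+k≤x : u₀ + k ≤ x
          u₀+k≤x = ℕ.≤-trans (ℕ.+-monoʳ-≤ u₀ (ℕ.m≤m+n k k)) (subst (u₀ + (k + k) ≤_) t+M≡x u₀≤)
          k≤x = ℕ.≤-trans (ℕ.m≤n+m k u₀) u₀+k≤x
          u , u₀≤u , u≤ , cut , last =
            greatest-below cut? (x ∸ k) (subst (_≤ x ∸ k) (ℕ.m+n∸n≡m u₀ k) (ℕ.∸-monoˡ-≤ k u₀+k≤x)) cut₀
          u+k≤x : u + k ≤ x
          u+k≤x = ℕ.≤-trans (ℕ.+-monoˡ-≤ k u≤) (ℕ.≤-reflexive (ℕ.m∸n+n≡m k≤x))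
          b , u+k+b≡x = ℕ.m≤n⇒∃[o]m+o≡n u+k≤x
          k+b≤M : k + b ≤ M
          k+b≤M = ℕ.+-cancelˡ-≤ u _ _ (begin
            u + (k + b) ≡⟨ ℕ.+-assoc u k b ⟨
            u + k + b   ≡⟨ u+k+b≡x ⟩
            x           ≡⟨ t+M≡x ⟨
            t + M       ≤⟨ ℕ.+-monoˡ-≤ M (ℕ.≤-trans t≤u₀ u₀≤u) ⟩
            u + M       ∎)
          b<M : b < M
          b<M = ℕ.≤-trans (ℕ.+-monoˡ-≤ b 1≤k) k+b≤M
      in record
        { u = u ; offset = Fin.fromℕ< b<M
        ; position = trans (cong (ℕ._+_ (u + k)) (Fin.toℕ-fromℕ< b<M)) u+k+b≡x
        ; cut = cut
        ; last = λ v u<v v+k≤x → last v u<v (subst (_≤ x ∸ k) (ℕ.m+n∸n≡m v k) (ℕ.∸-monoˡ-≤ k v+k≤x))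
        }
      where open ℕ.≤-Reasoning

  -- Cuts repeat with period `n`, so the last cut moves along with the position. Translating the
  -- given record, instead of searching anew, keeps its offset and hence its colour.
  shift : ∀ {x} a → LastCut x → LastCut (x + a * n)
  shift {x} a σ = record
    { u = u + a * n ; offset = offset
    ; position = trans (cong (_+ toℕ offset) (+-swap u (a * n) k))
        (trans (+-swap (u + k) (a * n) (toℕ offset)) (cong (_+ a * n) position))
    ; cut = subst (λ X → X) (sym (cut-periodic u a)) cut
    ; last = λ v u<v v+k≤x cut-v →
        let w , eq = ℕ.m≤n⇒∃[o]m+o≡n (ℕ.<⇒≤ u<v)
            v≡ : u + w + a * n ≡ v
            v≡ = trans (+-swap u w (a * n)) eq
        in last (u + w)
             (ℕ.+-cancelʳ-< (a * n) u (u + w) (subst (u + a * n <_) (sym v≡) u<v))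
             (ℕ.+-cancelʳ-≤ (a * n) (u + w + k) x
               (subst (_≤ x + a * n) (trans (cong (_+ k) (sym v≡)) (+-swap (u + w) (a * n) k)) v+k≤x))
             (subst (λ X → X) (cut-periodic (u + w) a) (subst Cut (sym v≡) cut-v))
    }
    where open LastCut σ

  abstract
    -- One choice is fixed for each starting vertex, so all positions of a stretch, and of its
    -- translates by `n`, draw on the same representatives.
    transversal : ∀ t → Transversal (λ (i : Fin M) → L (window t i))
    transversal t = hall⇒transversal _ (small-excess⇒hall _ 1≤c (λ i → ∣L∣≡c (window t i)) d+c² (spread t))

  colour : ∀ {x} → LastCut x → Fin s
  colour σ = proj₁ (transversal ((u + k) mod n)) offset
    where open LastCut σ

  colour-shift : ∀ {x} a (σ : LastCut x) → colour (shift a σ) ≡ colour σ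
  colour-shift a σ = cong (λ t → proj₁ (transversal t) offset)
    (trans (cong (_mod n) (+-swap u (a * n) k)) (mod-periodic (u + k) a))
    where open LastCut σ

  colour∈ : ∀ {x} (σ : LastCut x) → colour σ ∈ list x
  colour∈ σ = subst (λ j → colour σ ∈ L j) (trans (window-mod (u + k) offset) (cong (_mod n) position))
    (proj₁ (proj₂ (transversal ((u + k) mod n))) offset)
    where open LastCut σ

  same-cut-≢ : ∀ {x y} (σ : LastCut x) (τ : LastCut y) → LastCut.u σ ≡ LastCut.u τ → x ≢ y →
               colour σ ≢ colour τ
  same-cut-≢ record { u = u ; offset = a ; position = p } record { offset = b ; position = q } refl x≢y eq =
    x≢y (trans (sym p) (trans (cong (λ i → u + k + toℕ i) (proj₂ (proj₂ (transversal ((u + k) mod n))) eq)) q))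

  -- Let `v` be the cut of `y`. If its middle is at most `x`, it is also the cut of `x`, and
  -- injectivity of one transversal decides. Otherwise the middle separates `x` from `y`; being at
  -- most `k` apart, they lie in the two `k`-blocks of the cut, whose lists share no colour.
  colour-≢ : ∀ {x y} (σ : LastCut x) (τ : LastCut y) → x < y → y ≤ x + k → colour σ ≢ colour τ
  colour-≢ {x} {y} σ τ x<y y≤x+k with LastCut.u τ + k ℕ.≤? x
  ... | yes v+k≤x = same-cut-≢ σ τ (ℕ.≤-antisym u≤v v≤u) (ℕ.<⇒≢ x<y)
    where
    open LastCut σ using (u)
    open LastCut τ using () renaming (u to v)
    u+k≤x : u + k ≤ x
    u+k≤x = subst (u + k ≤_) (LastCut.position σ) (ℕ.m≤m+n (u + k) _)
    u≤v : u ≤ v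
    u≤v = ℕ.≮⇒≥ λ v<u → LastCut.last τ u v<u (ℕ.≤-trans u+k≤x (ℕ.<⇒≤ x<y)) (LastCut.cut σ)
    v≤u : v ≤ u
    v≤u = ℕ.≮⇒≥ λ u<v → LastCut.last σ v u<v v+k≤x (LastCut.cut τ)
  ... | no v+k≰x = λ eq → LastCut.cut τ (colour σ , x∈p∩q⁺
        ( ∈-span⁺ {i = proj₁ left} (proj₁ (proj₂ left)) (subst (λ z → colour σ ∈ list z) (sym (proj₂ (proj₂ left))) (colour∈ σ))
        , ∈-span⁺ {i = toℕ offset} offset<k (subst (λ z → colour σ ∈ list z) (sym position) (subst (_∈ list y) (sym eq) (colour∈ τ)))))
    where
    open LastCut τ renaming (u to v)
    x<v+k : x < v + k
    x<v+k = ℕ.≰⇒> v+k≰x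
    v+k≤y : v + k ≤ y
    v+k≤y = subst (v + k ≤_) position (ℕ.m≤m+n (v + k) _)
    left : ∃ λ i → i < k × v + i ≡ x
    left = let i , v+i≡x = ℕ.m≤n⇒∃[o]m+o≡n (ℕ.+-cancelʳ-≤ k v x (ℕ.≤-trans v+k≤y y≤x+k))
           in i , ℕ.+-cancelˡ-< v i k (subst (_< v + k) (sym v+i≡x) x<v+k) , v+i≡x
    offset<k : toℕ offset < k
    offset<k = ℕ.+-cancelˡ-< (v + k) (toℕ offset) k
      (subst (_< v + k + k) (sym position) (ℕ.≤-<-trans y≤x+k (ℕ.+-monoˡ-< k x<v+k)))

  -- The lift is raised by `n`, at least `M`, to leave room for a full window before it.
  lastCut′ : (i : Fin n) → LastCut (toℕ i + n)
  lastCut′ i = lastCut (toℕ i + n) (ℕ.≤-trans M≤n (ℕ.m≤n+m n (toℕ i)))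

  listColouring : Fin n → Fin s
  listColouring i = colour (lastCut′ i)

  -- Both vertices are shifted to lifts at distance `e` on the line, where `colour-≢` applies;
  -- shifting does not change the colours.
  offset-≢ : ∀ i j {e a b} → 1 ≤ e → e ≤ k → toℕ i + a * n ≡ toℕ j + e + b * n →
             listColouring j ≢ listColouring i
  offset-≢ i j {e} {a} {b} 1≤e e≤k eq same =
    colour-≢ (shift b (lastCut′ j)) (shift a (lastCut′ i))
      (subst (x <_) (sym y≡) (ℕ.<-≤-trans (ℕ.n<1+n x) (subst (_≤ x + e) (ℕ.+-comm x 1) (ℕ.+-monoʳ-≤ x 1≤e))))
      (subst (_≤ x + k) (sym y≡) (ℕ.+-monoʳ-≤ x e≤k))
      (trans (colour-shift b (lastCut′ j)) (trans same (sym (colour-shift a (lastCut′ i)))))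
    where
    x = toℕ j + n + b * n
    y≡ : toℕ i + n + a * n ≡ x + e
    y≡ = trans (+-swap (toℕ i) n (a * n)) (trans (cong (_+ n) eq) (regroup (toℕ j) e (b * n) n))
      where
      regroup : ∀ j e b n → j + e + b + n ≡ j + n + b + e
      regroup = solve-∀

  colourable : ListColourable (cyclePower n k) L
  colourable = listColouring
    , (λ i → subst (λ j → listColouring i ∈ L j) (trans (cong (λ m → (toℕ i + m) mod n) (sym (ℕ.*-identityˡ n)))
        (trans (mod-periodic (toℕ i) 1) (toℕ-mod-id i))) (colour∈ (lastCut′ i)))
    , proper
    where
    proper : ∀ i j → Graph.Adj (cyclePower n k) i j → listColouring i ≢ listColouring j
    proper i j (_ , near) with neighbour-offset i j near
    ... | e , 1≤e , e≤k , a , b , inj₁ eq = offset-≢ i j {e} {a} {b} 1≤e e≤k eq ∘ sym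
    ... | e , 1≤e , e≤k , a , b , inj₂ eq = offset-≢ j i {e} {a} {b} 1≤e e≤k eq

-- Counting list assignments

private variable
  X Y Z : Set

length-cartesianProductWith : (f : X → Y → Z) (xs : List X) (ys : List Y) →
  length (cartesianProductWith f xs ys) ≡ length xs * length ys
length-cartesianProductWith f []       ys = refl
length-cartesianProductWith f (x ∷ xs) ys = trans (length-++ (List.map (f x) ys))
  (cong₂ _+_ (length-map (f x) ys) (length-cartesianProductWith f xs ys))

length-vectors : (xs : List X) (n : ℕ) → length (vectors xs n) ≡ length xs ^ n
length-vectors xs zero    = refl
length-vectors xs (suc n) = trans (length-cartesianProductWith _∷_ xs (vectors xs n))
  (cong (length xs *_) (length-vectors xs n))

lookup-injective : {xs : List X} → Unique xs → Injective _≡_ _≡_ (List.lookup xs)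
lookup-injective (_ AllPairs.∷ _)    {zero}  {zero}  _  = refl
lookup-injective (x∉ AllPairs.∷ _)   {zero}  {suc j} eq = ⊥-elim (All.lookup x∉ (∈-lookup j) eq)
lookup-injective (x∉ AllPairs.∷ _)   {suc i} {zero}  eq = ⊥-elim (All.lookup x∉ (∈-lookup i) (sym eq))
lookup-injective (_ AllPairs.∷ uniq) {suc i} {suc j} eq = cong suc (lookup-injective uniq eq)

length-≤-injective : {xs : List X} {ys : List Y} (f : X → Y) → Injective _≡_ _≡_ f → Unique xs →
  (∀ {x} → x ∈ˡ xs → f x ∈ˡ ys) → length xs ≤ length ys
length-≤-injective {xs = xs} {ys} f f-inj uniq f∈ =
  Fin.injective⇒≤ {f = λ i → Any.index (f∈ (∈-lookup {xs = xs} i))} λ {i} {j} eq →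
    lookup-injective uniq (f-inj (trans (lookup-index (f∈ (∈-lookup i)))
      (trans (cong (List.lookup ys) eq) (sym (lookup-index (f∈ (∈-lookup j)))))))

length-≤-⊆ : {xs ys : List X} → Unique xs → (∀ {x} → x ∈ˡ xs → x ∈ˡ ys) → length xs ≤ length ys
length-≤-⊆ = length-≤-injective (λ x → x) (λ eq → eq)

-- The union bound, with the denominator `a` kept as a factor to stay within natural numbers.
length-concatMap-≤ : (f : X → List Y) (xs : List X) {a b : ℕ} →
  (∀ x → length (f x) * a ≤ b) → length (concatMap f xs) * a ≤ length xs * b
length-concatMap-≤ f []       h = z≤n
length-concatMap-≤ f (x ∷ xs) {a} {b} h = begin
  length (f x List.++ concatMap f xs) * a         ≡⟨ cong (_* a) (length-++ (f x)) ⟩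
  (length (f x) + length (concatMap f xs)) * a    ≡⟨ ℕ.*-distribʳ-+ a (length (f x)) _ ⟩
  length (f x) * a + length (concatMap f xs) * a  ≤⟨ ℕ.+-mono-≤ (h x) (length-concatMap-≤ f xs h) ⟩
  b + length xs * b                               ∎
  where open ℕ.≤-Reasoning

length-filter-¬ : {P : X → Set} (P? : Decidable P) (xs : List X) →
  length (filter P? xs) + length (filter (¬? ∘ P?) xs) ≡ length xs
length-filter-¬ P? []       = refl
length-filter-¬ P? (x ∷ xs) with P? x
... | yes _ = cong suc (length-filter-¬ P? xs)
... | no _  = trans (ℕ.+-suc _ _) (cong suc (length-filter-¬ P? xs))

tabulate-injective : {f g : Fin m → X} → tabulate f ≡ tabulate g → ∀ i → f i ≡ g i
tabulate-injective {f = f} {g} eq i = trans (sym (Vec.lookup∘tabulate f i))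
  (trans (cong (λ v → lookup v i) eq) (Vec.lookup∘tabulate g i))

lookup-extensional : {u v : Vec X m} → (∀ i → lookup u i ≡ lookup v i) → u ≡ v
lookup-extensional {u = u} {v} eq = trans (sym (Vec.tabulate∘lookup u))
  (trans (Vec.tabulate-cong eq) (Vec.tabulate∘lookup v))

module _ {M n : ℕ} (w : Fin M → Fin n) (w-inj : Injective _≡_ _≡_ w) {A : Set} where

  overwrite : (Fin n → A) → (Fin M → A) → Fin n → A
  overwrite f g i with Fin.any? (λ j → w j Fin.≟ i)
  ... | yes (j , _) = g j
  ... | no _        = f i

  overwrite-at : ∀ f g j → overwrite f g (w j) ≡ g j
  overwrite-at f g j with Fin.any? (λ j′ → w j′ Fin.≟ w j)
  ... | yes (j′ , eq) = cong g (w-inj eq)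
  ... | no ¬∃         = ⊥-elim (¬∃ (j , refl))

  overwrite-∈ : ∀ {xs : List A} f g → (∀ i → f i ∈ˡ xs) → (∀ j → g j ∈ˡ xs) → ∀ i → overwrite f g i ∈ˡ xs
  overwrite-∈ f g f∈ g∈ i with Fin.any? (λ j → w j Fin.≟ i)
  ... | yes (j , _) = g∈ j
  ... | no _        = f∈ i

  overwrite-cancel : ∀ f f′ g g′ → (∀ i → overwrite f g i ≡ overwrite f′ g′ i) →
                     (∀ j → f (w j) ≡ f′ (w j)) → ∀ i → f i ≡ f′ i
  overwrite-cancel f f′ g g′ eq eq-w i with Fin.any? (λ j → w j Fin.≟ i) | eq i
  ... | yes (j , refl) | _ = eq-w j
  ... | no _           | e = e

  -- Puts `g` into the window and hands back what stood there. Nothing is lost, hence injectivity,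
  -- and any condition on the window of `f` becomes one on the second component alone.
  exchange : Vec A n × Vec A M → Vec A n × Vec A M
  exchange (f , g) = tabulate (overwrite (lookup f) (lookup g)) , tabulate (lookup f ∘ w)

  exchange-injective : Injective _≡_ _≡_ exchange
  exchange-injective {f , g} {f′ , g′} eq = cong₂ _,_
    (lookup-extensional (overwrite-cancel (lookup f) (lookup f′) (lookup g) (lookup g′) over≡ off≡))
    (lookup-extensional λ j → trans (sym (overwrite-at (lookup f) (lookup g) j))
      (trans (over≡ (w j)) (overwrite-at (lookup f′) (lookup g′) j)))
    where
    over≡ = tabulate-injective (cong proj₁ eq)
    off≡  = tabulate-injective (cong proj₂ eq)

  -- Independence of the entries outside the window, in the form
  -- (number of f with f ∘ w ∈ ys) / ∣xs∣ ^ n ≤ ∣ys∣ / ∣xs∣ ^ M.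
  window-count : {P : Vec A n → Set} (P? : Decidable P) {xs : List A} (ys : List (Vec A M)) → Unique xs →
    (∀ {f} → f ∈ˡ vectors xs n → P f → tabulate (lookup f ∘ w) ∈ˡ ys) →
    length (filter P? (vectors xs n)) * length xs ^ M ≤ length xs ^ n * length ys
  window-count P? {xs} ys uniq P⇒∈ = begin
    length fs * length xs ^ M                          ≡⟨ cong (length fs *_) (length-vectors xs M) ⟨
    length fs * length (vectors xs M)                  ≡⟨ length-cartesianProductWith _,_ fs (vectors xs M) ⟨
    length (cartesianProduct fs (vectors xs M))        ≤⟨ length-≤-injective exchange exchange-injective
                                                            (Unique.cartesianProduct⁺ (Unique.filter⁺ P? (vectors-unique uniq n)) (vectors-unique uniq M))
                                                            into ⟩
    length (cartesianProduct (vectors xs n) ys)        ≡⟨ length-cartesianProductWith _,_ (vectors xs n) ys ⟩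
    length (vectors xs n) * length ys                  ≡⟨ cong (_* length ys) (length-vectors xs n) ⟩
    length xs ^ n * length ys                          ∎
    where
    open ℕ.≤-Reasoning
    fs = filter P? (vectors xs n)
    into : ∀ {fg} → fg ∈ˡ cartesianProduct fs (vectors xs M) →
           exchange fg ∈ˡ cartesianProduct (vectors xs n) ys
    into {f , g} fg∈ =
      let f∈fs , g∈ = ∈-cartesianProduct⁻ fs (vectors xs M) fg∈
          f∈ , Pf   = ∈-filter⁻ P? {xs = vectors xs n} f∈fs
      in ∈-cartesianProduct⁺
        (∈-vectors⁺ _ λ i → subst (_∈ˡ xs) (sym (Vec.lookup∘tabulate _ i))
          (overwrite-∈ (lookup f) (lookup g) (∈-vectors⁻ f∈) (∈-vectors⁻ g∈) i))
        (P⇒∈ f∈ Pf)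

module _ {s : ℕ} where

  -- The colour `z` only pads the vector once `U` is exhausted. The fixed length lets every set of
  -- at most `d` colours be coded by one of `s ^ d` tuples.
  enumerate : ∀ d → Fin s → Subset s → Vec (Fin s) d
  enumerate zero    z U = []
  enumerate (suc d) z U with nonempty? U
  ... | yes (x , _) = x ∷ enumerate d z (U - x)
  ... | no _        = replicate (suc d) z

  enumerate-covers : ∀ d z U {x} → ∣ U ∣ ≤ d → x ∈ U → ∃ λ i → lookup (enumerate d z U) i ≡ x
  enumerate-covers zero    z U ∣U∣≤0 x∈ = ⊥-elim (ℕ.<⇒≱ (x∈p⇒1≤∣p∣ x∈) ∣U∣≤0)
  enumerate-covers (suc d) z U {x} ∣U∣≤ x∈ with nonempty? U
  ... | no empty = ⊥-elim (empty (x , x∈))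
  ... | yes (y , y∈) with x Fin.≟ y
  ...   | yes refl = zero , refl
  ...   | no x≢y   =
    let i , eq = enumerate-covers d z (U - y) (ℕ.s≤s⁻¹ (ℕ.≤-trans (x∈p⇒∣p-x∣<∣p∣ y∈) ∣U∣≤)) (x∈p∧x≢y⇒x∈p-y x∈ x≢y)
    in suc i , eq

  image : ∀ {d} → Vec (Fin s) d → Subset d → Subset s
  image D E = ⋃[ E ] (λ i → ⁅ lookup D i ⁆)

  -- The code of `A` marks each index of `D` whose colour lies in `A`. Repeated colours in `D` are
  -- harmless, since their indices are marked alike.
  image-preimage : ∀ {d} (D : Vec (Fin s) d) (A : Subset s) → (∀ {x} → x ∈ A → ∃ λ i → lookup D i ≡ x) →
                   image D (Vec.map (lookup A) D) ≡ A
  image-preimage D A surj = ⊆-antisym to from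
    where
    to : image D (Vec.map (lookup A) D) ⊆ A
    to {x} x∈ with ∈-⋃⁻ (Vec.map (lookup A) D) (λ i → ⁅ lookup D i ⁆) x∈
    ... | i , i∈ , x∈Dᵢ rewrite x∈⁅y⁆⇒x≡y (lookup D i) x∈Dᵢ =
      Vec.lookup⇒[]= _ A (trans (sym (Vec.lookup-map i (lookup A) D)) (Vec.[]=⇒lookup i∈))
    from : A ⊆ image D (Vec.map (lookup A) D)
    from {x} x∈ with surj x∈
    ... | i , refl = ∈-⋃⁺ (λ i → ⁅ lookup D i ⁆)
      (Vec.lookup⇒[]= i (Vec.map (lookup A) D) (trans (Vec.lookup-map i (lookup A) D) (Vec.[]=⇒lookup x∈))) (x∈⁅x⁆ _)

allSubsets : ∀ d → List (Subset d)
allSubsets = vectors (inside ∷ outside ∷ [])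

∈-allSubsets : ∀ {d} (E : Subset d) → E ∈ˡ allSubsets d
∈-allSubsets E = ∈-vectors⁺ E λ i → side (lookup E i)
  where
  side : ∀ b → b ∈ˡ (inside ∷ outside ∷ [])
  side inside  = here refl
  side outside = there (here refl)

-- A family is coded by `d` colours and, for each member, a set of indices into them. Duplicates and
-- members of any size are tolerated: this is an upper bound, in which `s` enters only with exponent
-- `d`.
familiesWithin : ∀ d M s → List (Vec (Subset s) M)
familiesWithin d M s = cartesianProductWith (λ D → Vec.map (image D)) (vectors (allFin s) d) (vectors (allSubsets d) M)

length-familiesWithin : ∀ d M s → length (familiesWithin d M s) ≡ s ^ d * (2 ^ d) ^ M
length-familiesWithin d M s = trans (length-cartesianProductWith _ (vectors (allFin s) d) (vectors (allSubsets d) M))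
  (cong₂ _*_ (trans (length-vectors (allFin s) d) (cong (_^ d) (length-tabulate (λ (x : Fin s) → x))))
    (trans (length-vectors (allSubsets d) M) (cong (_^ M) (length-vectors (inside ∷ outside ∷ []) d))))

∈-familiesWithin : ∀ {d M s} → Fin s → (A : Fin M → Subset s) → ∣ ⋃[ ⊤ ] A ∣ ≤ d →
                   tabulate A ∈ˡ familiesWithin d M s
∈-familiesWithin {d} {M} {s} z A ∣⋃∣≤d = subst (_∈ˡ familiesWithin d M s) recover
  (∈-cartesianProductWith⁺ (λ D → Vec.map (image D)) (∈-vectors⁺ D λ _ → ∈-allFin _)
    (∈-vectors⁺ (tabulate E) λ _ → ∈-allSubsets _))
  where
  D = enumerate d z (⋃[ ⊤ ] A)
  E : Fin M → Subset d
  E i = Vec.map (lookup (A i)) D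
  recover : Vec.map (image D) (tabulate E) ≡ tabulate A
  recover = trans (sym (Vec.tabulate-∘ (image D) E)) (Vec.tabulate-cong λ i →
    image-preimage D (A i) λ x∈ → enumerate-covers d z (⋃[ ⊤ ] A) ∣⋃∣≤d (∈-⋃⁺ A ∈⊤ x∈))

extend : ∀ {c s} (I : Subset s) → ∣ I ∣ ≤ c → c ≤ s → ∃ λ A → I ⊆ A × ∣ A ∣ ≡ c
extend []            _         z≤n       = [] , (λ x∈ → x∈) , refl
extend (inside  ∷ I) (s≤s ∣I∣≤) (s≤s c≤s) =
  let A , I⊆A , eq = extend I ∣I∣≤ c≤s in inside ∷ A , s⊆s I⊆A , cong suc eq
extend {c} {suc s} (outside ∷ I) ∣I∣≤ c≤1+s with c ℕ.≤? s
... | yes c≤s = let A , I⊆A , eq = extend I ∣I∣≤ c≤s in outside ∷ A , s⊆s I⊆A , eq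
-- Here `c` equals `suc s`, so the whole set is the only choice.
... | no c≰s  = ⊤ , ⊆⊤ , trans (∣⊤∣≡n (suc s)) (ℕ.≤-antisym (ℕ.≰⇒> c≰s) c≤1+s)

-- Every sequence of c colours lists elements of some c-subset.
s^c≤subsets*c^c : ∀ {c s} → 1 ≤ c → c ≤ s → s ^ c ≤ length (subsetsOfSize c s) * c ^ c
s^c≤subsets*c^c {c} {s} 1≤c c≤s = begin
  s ^ c                                              ≡⟨ cong (_^ c) (length-tabulate (λ (x : Fin s) → x)) ⟨
  length (allFin s) ^ c                              ≡⟨ length-vectors (allFin s) c ⟨
  length (vectors (allFin s) c)                      ≤⟨ length-≤-⊆ (vectors-unique (Unique.allFin⁺ s) c) (λ {v} _ → covered v) ⟩
  length (cartesianProductWith pick (subsetsOfSize c s) (vectors (allFin c) c))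
                                                     ≡⟨ length-cartesianProductWith pick (subsetsOfSize c s) (vectors (allFin c) c) ⟩
  length (subsetsOfSize c s) * length (vectors (allFin c) c)
                                                     ≡⟨ cong (length (subsetsOfSize c s) *_) (trans (length-vectors (allFin c) c)
                                                          (cong (_^ c) (length-tabulate (λ (x : Fin c) → x)))) ⟩
  length (subsetsOfSize c s) * c ^ c                 ∎
  where
  open ℕ.≤-Reasoning
  z : Fin s
  z = Fin.fromℕ< (ℕ.≤-trans 1≤c c≤s)
  pick : Subset s → Vec (Fin c) c → Vec (Fin s) c
  pick A = Vec.map (lookup (enumerate c z A))
  covered : ∀ v → v ∈ˡ cartesianProductWith pick (subsetsOfSize c s) (vectors (allFin c) c)
  covered v = subst (_∈ˡ _) recover (∈-cartesianProductWith⁺ pick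
      (Equivalence.from ∈-subsetsOfSize ∣A∣≡c) (∈-vectors⁺ (tabulate g) λ _ → ∈-allFin _))
    where
    points : Fin c → Subset s
    points i = ⁅ lookup v i ⁆
    extension = extend (⋃[ ⊤ ] points) (begin
      ∣ ⋃[ ⊤ ] points ∣   ≤⟨ ∣⋃∣≤∣J∣*c ⊤ points (λ i → ℕ.≤-reflexive (∣⁅x⁆∣≡1 (lookup v i))) ⟩
      ∣ ⊤ {n = c} ∣ * 1   ≡⟨ ℕ.*-identityʳ ∣ ⊤ {n = c} ∣ ⟩
      ∣ ⊤ {n = c} ∣       ≡⟨ ∣⊤∣≡n c ⟩
      c                   ∎) c≤s
    A = proj₁ extension
    ∣A∣≡c = proj₂ (proj₂ extension)
    index : ∀ i → ∃ λ j → lookup (enumerate c z A) j ≡ lookup v i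
    index i = enumerate-covers c z A (ℕ.≤-reflexive ∣A∣≡c)
      (proj₁ (proj₂ extension) (∈-⋃⁺ points (∈⊤ {x = i}) (x∈⁅x⁆ (lookup v i))))
    g : Fin c → Fin c
    g = proj₁ ∘ index
    recover : pick A (tabulate g) ≡ v
    recover = trans (sym (Vec.tabulate-∘ (lookup (enumerate c z A)) g))
      (trans (Vec.tabulate-cong (proj₂ ∘ index)) (Vec.tabulate∘lookup v))

-- Positions with equal residues differ by a multiple of `n`, and indices below `M ≤ n` leave room
-- only for zero. In `half`, a larger quotient for `j` would force `toℕ j` to be at least `n`.
window-injective : ∀ {n M} .{{_ : NonZero n}} → M ≤ n → (t : Fin n) → Injective _≡_ _≡_ (window {n} {M} t)
window-injective {n} {M} M≤n t {i} {j} eq = Fin.toℕ-injective (ℕ.≤-antisym (half j i (sym eq)) (half i j eq))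
  where
  half : ∀ i j → window {n} {M} t i ≡ window t j → toℕ j ≤ toℕ i
  half i j eq = ℕ.+-cancelˡ-≤ (toℕ t) (toℕ j) (toℕ i) (begin
      toℕ t + toℕ j     ≡⟨ m≡m%n+[m/n]*n b n ⟩
      b % n + b / n * n ≡⟨ cong (_+ b / n * n) same ⟨
      a % n + b / n * n ≤⟨ ℕ.+-monoʳ-≤ (a % n) (ℕ.*-monoˡ-≤ n q≤) ⟩
      a % n + a / n * n ≡⟨ m≡m%n+[m/n]*n a n ⟨
      toℕ t + toℕ i     ∎)
    where
    open ℕ.≤-Reasoning
    a = toℕ t + toℕ i
    b = toℕ t + toℕ j
    same : a % n ≡ b % n
    same = trans (sym (toℕ-mod a)) (trans (cong toℕ eq) (toℕ-mod b))
    q≤ : b / n ≤ a / n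
    q≤ = ℕ.≮⇒≥ λ lt → ℕ.<⇒≱ (ℕ.<-≤-trans (Fin.toℕ<n j) (ℕ.≤-trans M≤n (ℕ.m≤m+n n (toℕ i))))
      (ℕ.+-cancelˡ-≤ (toℕ t) (n + toℕ i) (toℕ j) (begin
        toℕ t + (n + toℕ i)     ≡⟨ regroup (toℕ t) n (toℕ i) ⟩
        n + a                   ≡⟨ cong (n +_) (m≡m%n+[m/n]*n a n) ⟩
        n + (a % n + a / n * n) ≡⟨ regroup (a % n) n (a / n * n) ⟨
        a % n + suc (a / n) * n ≤⟨ ℕ.+-monoʳ-≤ (a % n) (ℕ.*-monoˡ-≤ n lt) ⟩
        a % n + b / n * n       ≡⟨ cong (_+ b / n * n) same ⟩
        b % n + b / n * n       ≡⟨ m≡m%n+[m/n]*n b n ⟨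
        b                       ∎))
      where
      regroup : ∀ x y z → x + (y + z) ≡ y + (x + z)
      regroup = solve-∀

-- Union bound over the windows

uncolourable? : ∀ n k {s} → Decidable (λ (L : Vec (Subset s) n) → ¬ ListColourable (cyclePower n k) (lookup L))
uncolourable? n k L = ¬? (listColourable? (cyclePower n k) (lookup L))

-- The constant of the estimate, free of `n` and `s`: the first factor counts index patterns, the
-- second pays for bounding the number of `c`-subsets below by `s ^ c` over `c ^ c`.
patternBound : (c M d : ℕ) → ℕ
patternBound c M d = (2 ^ d) ^ M * (c ^ c) ^ M

module _ {n s c k M d : ℕ} .{{_ : NonZero n}} (1≤c : 1 ≤ c) (1≤k : 1 ≤ k) (c≤s : c ≤ s)
  (M≡ : M ≡ c * c * (k + k)) (d+c² : d + c * c ≡ c * M) (M≤n : M ≤ n) where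

  private
    subsets = subsetsOfSize c s
    N = length subsets
    instance
      s≢0 : NonZero s
      s≢0 = ℕ.>-nonZero (ℕ.≤-trans 1≤c c≤s)

  crowded? : (t : Fin n) → Decidable (λ (L : Vec (Subset s) n) → ∣ ⋃[ ⊤ ] (λ (i : Fin M) → lookup L (window t i)) ∣ ≤ d)
  crowded? t L = _ ℕ.≤? d

  uncolourable⇒crowded : ∀ {L} → L ∈ˡ listAssignments n c s → ¬ ListColourable (cyclePower n k) (lookup L) →
    ∃ λ t → ∣ ⋃[ ⊤ ] (λ (i : Fin M) → lookup L (window t i)) ∣ ≤ d
  uncolourable⇒crowded {L} L∈ ¬col with Fin.any? (λ t → crowded? t L)
  ... | yes found = found
  ... | no ¬found = ⊥-elim (¬col (CutAndColour.colourable 1≤c 1≤k M≡ d+c² M≤n (lookup L)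
    (λ i → Equivalence.to ∈-subsetsOfSize (∈-vectors⁻ L∈ i)) λ t → ℕ.≰⇒> λ few → ¬found (t , few)))

  -- At most `s ^ d * (2 ^ d) ^ M` of the `N ^ M` window contents are crowded, and `N ^ M` is at
  -- least `s ^ (c * M)` over `(c ^ c) ^ M`. Cancelling `s ^ d` leaves the exponent `c * M - d`,
  -- which is `c * c`.
  crowded-count : ∀ t → length (filter (crowded? t) (listAssignments n c s)) * s ^ (c * c) ≤ N ^ n * patternBound c M d
  crowded-count t = ℕ.*-cancelˡ-≤ (s ^ d) {{ℕ.m^n≢0 s d}} (begin
    s ^ d * (B * s ^ (c * c))                           ≡⟨ regroup₁ (s ^ d) B (s ^ (c * c)) ⟩
    B * (s ^ d * s ^ (c * c))                           ≡⟨ cong (B *_) (ℕ.^-distribˡ-+-* s d (c * c)) ⟨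
    B * s ^ (d + c * c)                                 ≡⟨ cong (λ e → B * s ^ e) d+c² ⟩
    B * s ^ (c * M)                                     ≡⟨ cong (B *_) (ℕ.^-*-assoc s c M) ⟨
    B * (s ^ c) ^ M                                     ≤⟨ ℕ.*-monoʳ-≤ B (ℕ.^-monoˡ-≤ M (s^c≤subsets*c^c 1≤c c≤s)) ⟩
    B * (N * c ^ c) ^ M                                 ≡⟨ cong (B *_) (^-distribʳ-* N (c ^ c) M) ⟩
    B * (N ^ M * (c ^ c) ^ M)                           ≡⟨ ℕ.*-assoc B (N ^ M) _ ⟨
    B * N ^ M * (c ^ c) ^ M                             ≤⟨ ℕ.*-monoˡ-≤ ((c ^ c) ^ M) (window-count (window t) (window-injective M≤n t)
                                                             (crowded? t) (familiesWithin d M s) (subsetsOfSize-unique c s)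
                                                             λ {L} _ → ∈-familiesWithin z (lookup L ∘ window t)) ⟩
    N ^ n * length (familiesWithin d M s) * (c ^ c) ^ M ≡⟨ cong (λ l → N ^ n * l * (c ^ c) ^ M) (length-familiesWithin d M s) ⟩
    N ^ n * (s ^ d * (2 ^ d) ^ M) * (c ^ c) ^ M         ≡⟨ regroup₂ (N ^ n) (s ^ d) ((2 ^ d) ^ M) ((c ^ c) ^ M) ⟩
    s ^ d * (N ^ n * patternBound c M d)                          ∎)
    where
    open ℕ.≤-Reasoning
    B = length (filter (crowded? t) (listAssignments n c s))
    z : Fin s
    z = Fin.fromℕ< (ℕ.≤-trans 1≤c c≤s)
    regroup₁ : ∀ x y z → x * (y * z) ≡ y * (x * z)
    regroup₁ = solve-∀
    regroup₂ : ∀ x y z w → x * (y * z) * w ≡ y * (x * (z * w))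
    regroup₂ = solve-∀
    ^-distribʳ-* : ∀ a b m → (a * b) ^ m ≡ a ^ m * b ^ m
    ^-distribʳ-* a b zero    = refl
    ^-distribʳ-* a b (suc m) = trans (cong (a * b *_) (^-distribʳ-* a b m)) (regroup₃ a b (a ^ m) (b ^ m))
      where
      regroup₃ : ∀ a b x y → a * b * (x * y) ≡ a * x * (b * y)
      regroup₃ = solve-∀

  uncolourable-count :
    length (filter (uncolourable? n k) (listAssignments n c s)) * s ^ (c * c) ≤ n * (length (listAssignments n c s) * patternBound c M d)
  uncolourable-count = begin
    length (filter (uncolourable? n k) assignments) * s ^ (c * c)    ≤⟨ ℕ.*-monoˡ-≤ (s ^ (c * c)) (length-≤-⊆
                                                                     (Unique.filter⁺ (uncolourable? n k) (vectors-unique (subsetsOfSize-unique c s) n)) covered) ⟩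
    length (concatMap crowded (allFin n)) * s ^ (c * c)        ≤⟨ length-concatMap-≤ crowded (allFin n) crowded-count ⟩
    length (allFin n) * (N ^ n * patternBound c M d)                     ≡⟨ cong₂ (λ a b → a * (b * patternBound c M d)) (length-tabulate (λ (t : Fin n) → t)) (sym (length-vectors subsets n)) ⟩
    n * (length assignments * patternBound c M d)                        ∎
    where
    open ℕ.≤-Reasoning
    assignments = listAssignments n c s
    crowded : Fin n → List (Vec (Subset s) n)
    crowded t = filter (crowded? t) assignments
    covered : ∀ {L} → L ∈ˡ filter (uncolourable? n k) assignments → L ∈ˡ concatMap crowded (allFin n)
    covered L∈ =
      let L∈as , ¬col = ∈-filter⁻ (uncolourable? n k) {xs = assignments} L∈
          t , few     = uncolourable⇒crowded L∈as ¬col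
      in ∈-concatMap⁺ crowded {xs = allFin n} (lose (∈-allFin t) (∈-filter⁺ (crowded? t) L∈as few))

-- Rational estimates

open import Data.Integer using (+_)

toℚᵘ-/ : ∀ a b .{{_ : NonZero b}} → ℚ.toℚᵘ (+ a ℚ./ b) ℚᵘ.≃ + a ℚᵘ./ b
toℚᵘ-/ a (suc b) = ℚ.toℚᵘ-fromℚᵘ (ℚᵘ.mkℚᵘ (+ a) b)

fromℕ-* : ∀ a b → fromℕ a ℚ.* fromℕ b ≡ fromℕ (a * b)
fromℕ-* a b = ℚ.toℚᵘ-injective (begin
  ℚ.toℚᵘ (fromℕ a ℚ.* fromℕ b)               ≈⟨ ℚ.toℚᵘ-homo-* (fromℕ a) (fromℕ b) ⟩
  ℚ.toℚᵘ (fromℕ a) ℚᵘ.* ℚ.toℚᵘ (fromℕ b)     ≈⟨ ℚᵘ.*-cong (toℚᵘ-/ a 1) (toℚᵘ-/ b 1) ⟩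
  (+ a ℚᵘ./ 1) ℚᵘ.* (+ b ℚᵘ./ 1)             ≈⟨ ℚᵘ.*≡* (cong (ℤ._* + 1) (sym (ℤ.pos-* a b))) ⟩
  + (a * b) ℚᵘ./ 1                           ≈⟨ toℚᵘ-/ (a * b) 1 ⟨
  ℚ.toℚᵘ (fromℕ (a * b))                     ∎)
  where open ℚᵘ.≃-Reasoning

fromℕ-^ : ∀ a m → fromℕ a ℚ^.^ m ≡ fromℕ (a ^ m)
fromℕ-^ a zero    = refl
fromℕ-^ a (suc m) = trans (cong (fromℕ a ℚ.*_) (fromℕ-^ a m)) (fromℕ-* a (a ^ m))

/-*-cancel : ∀ q .{{_ : NonZero q}} → (+ 1 ℚ./ q) ℚ.* fromℕ q ≡ 1ℚ
/-*-cancel q@(suc _) = ℚ.toℚᵘ-injective (begin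
  ℚ.toℚᵘ ((+ 1 ℚ./ q) ℚ.* fromℕ q)             ≈⟨ ℚ.toℚᵘ-homo-* (+ 1 ℚ./ q) (fromℕ q) ⟩
  ℚ.toℚᵘ (+ 1 ℚ./ q) ℚᵘ.* ℚ.toℚᵘ (fromℕ q)     ≈⟨ ℚᵘ.*-cong (toℚᵘ-/ 1 q) (toℚᵘ-/ q 1) ⟩
  (+ 1 ℚᵘ./ q) ℚᵘ.* (+ q ℚᵘ./ 1)               ≈⟨ ℚᵘ.*≡* (cong (+_) (one q)) ⟩
  ℚ.toℚᵘ 1ℚ                                    ∎)
  where
  open ℚᵘ.≃-Reasoning
  one : ∀ q → 1 * q * 1 ≡ 1 * (q * 1)
  one = solve-∀

fromℕ-cancel-< : ∀ {a b} → fromℕ a ℚ.< fromℕ b → a < b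
fromℕ-cancel-< {a} {b} lt = ℤ.drop‿+<+ (subst₂ ℤ._<_ (ℤ.*-identityʳ (+ a)) (ℤ.*-identityʳ (+ b))
  (ℚᵘ.drop-*<* (ℚᵘ.<-respˡ-≃ (toℚᵘ-/ a 1) (ℚᵘ.<-respʳ-≃ (toℚᵘ-/ b 1) (ℚ.toℚᵘ-mono-< lt)))))

fromℕ-pos : ∀ a .{{_ : NonZero a}} → ℚ.Positive (fromℕ a)
fromℕ-pos (suc a) = ℚ.normalize-pos (suc a) 1

-- Clears the denominator of the factor `1 / q`, so that the remaining estimate takes place in
-- natural numbers.
root-bound : ∀ {n C s} q .{{_ : NonZero q}} → n ^1/ C < ((+ 1 ℚ./ q) ℚ.* fromℕ s) →
             n * q ^ C < s ^ C
root-bound {n} {C} {s} q (_ , lt) = fromℕ-cancel-< (subst₂ ℚ._<_ lhs rhs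
    (ℚ.*-monoˡ-<-pos (fromℕ (q ^ C)) {{fromℕ-pos (q ^ C) {{ℕ.m^n≢0 q C}}}} lt))
  where
  open ≡-Reasoning
  lhs : fromℕ n ℚ.* fromℕ (q ^ C) ≡ fromℕ (n * q ^ C)
  lhs = fromℕ-* n (q ^ C)
  rhs : ((+ 1 ℚ./ q) ℚ.* fromℕ s) ℚ^.^ C ℚ.* fromℕ (q ^ C) ≡ fromℕ (s ^ C)
  rhs = begin
    ((+ 1 ℚ./ q) ℚ.* fromℕ s) ℚ^.^ C ℚ.* fromℕ (q ^ C)   ≡⟨ cong (((+ 1 ℚ./ q) ℚ.* fromℕ s) ℚ^.^ C ℚ.*_) (fromℕ-^ q C) ⟨
    ((+ 1 ℚ./ q) ℚ.* fromℕ s) ℚ^.^ C ℚ.* fromℕ q ℚ^.^ C    ≡⟨ ℚ^.^-distrib-* _ (fromℕ q) C ⟨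
    ((+ 1 ℚ./ q) ℚ.* fromℕ s ℚ.* fromℕ q) ℚ^.^ C           ≡⟨ cong (ℚ^._^ C) (begin
      (+ 1 ℚ./ q) ℚ.* fromℕ s ℚ.* fromℕ q                  ≡⟨ cong (ℚ._* fromℕ q) (ℚ.*-comm (+ 1 ℚ./ q) (fromℕ s)) ⟩
      fromℕ s ℚ.* (+ 1 ℚ./ q) ℚ.* fromℕ q                  ≡⟨ ℚ.*-assoc (fromℕ s) (+ 1 ℚ./ q) (fromℕ q) ⟩
      fromℕ s ℚ.* ((+ 1 ℚ./ q) ℚ.* fromℕ q)                ≡⟨ cong (fromℕ s ℚ.*_) (/-*-cancel q) ⟩
      fromℕ s ℚ.* 1ℚ                                       ≡⟨ ℚ.*-identityʳ (fromℕ s) ⟩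
      fromℕ s                                              ∎) ⟩
    fromℕ s ℚ^.^ C                                         ≡⟨ fromℕ-^ s C ⟩
    fromℕ (s ^ C)                                        ∎

/-+-/ : ∀ a b t .{{_ : NonZero t}} → (+ a ℚ./ t) ℚ.+ (+ b ℚ./ t) ≡ + (a + b) ℚ./ t
/-+-/ a b t@(suc _) = ℚ.toℚᵘ-injective (begin
  ℚ.toℚᵘ ((+ a ℚ./ t) ℚ.+ (+ b ℚ./ t))             ≈⟨ ℚ.toℚᵘ-homo-+ (+ a ℚ./ t) (+ b ℚ./ t) ⟩
  ℚ.toℚᵘ (+ a ℚ./ t) ℚᵘ.+ ℚ.toℚᵘ (+ b ℚ./ t)       ≈⟨ ℚᵘ.+-cong (toℚᵘ-/ a t) (toℚᵘ-/ b t) ⟩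
  (+ a ℚᵘ./ t) ℚᵘ.+ (+ b ℚᵘ./ t)                   ≈⟨ ℚᵘ.*≡* common ⟩
  + (a + b) ℚᵘ./ t                               ≈⟨ toℚᵘ-/ (a + b) t ⟨
  ℚ.toℚᵘ (+ (a + b) ℚ./ t)                       ∎)
  where
  open ℚᵘ.≃-Reasoning
  common : (+ a ℤ.* + t ℤ.+ + b ℤ.* + t) ℤ.* + t ≡ + (a + b) ℤ.* + (t * t)
  common = trans (cong (ℤ._* + t) (sym (ℤ.*-distribʳ-+ (+ t) (+ a) (+ b))))
    (trans (ℤ.*-assoc (+ (a + b)) (+ t) (+ t)) (cong (ℤ._*_ (+ (a + b))) (sym (ℤ.pos-* t t))))

n/n≡1 : ∀ t .{{_ : NonZero t}} → + t ℚ./ t ≡ 1ℚ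
n/n≡1 t@(suc _) = ℚ.toℚᵘ-injective (ℚᵘ.≃-trans (toℚᵘ-/ t t) (ℚᵘ.*≡* (ℤ.*-comm (+ t) (+ 1))))

-- A positive `ε` has numerator at least one, so being below the reciprocal of its denominator is
-- enough.
/-<-positive : ∀ b t .{{_ : NonZero t}} {ε} → 0ℚ ℚ.< ε → b * ↧ₙ ε < t → + b ℚ./ t ℚ.< ε
/-<-positive b t@(suc _) {ε} 0<ε b*↧ε<t = ℚ.toℚᵘ-cancel-< (ℚᵘ.<-respˡ-≃ (ℚᵘ.≃-sym (toℚᵘ-/ b t))
    (ℚᵘ.*<* (cross ε (ℚ.drop-*<* 0<ε) b*↧ε<t)))
  where
  cross : ∀ ε → + 0 ℤ.* ↧ ε ℤ.< ↥ ε ℤ.* + 1 → b * ↧ₙ ε < t →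
          + b ℤ.* ℚᵘ.↧ (ℚ.toℚᵘ ε) ℤ.< ℚᵘ.↥ (ℚ.toℚᵘ ε) ℤ.* + t
  cross (ℚ.mkℚ (+ zero) _ _) (ℤ.+<+ ()) _
  cross (ℚ.mkℚ (+ suc a) e _) _ lt = subst₂ ℤ._<_ (ℤ.pos-* b (suc e)) (ℤ.pos-* (suc a) t)
    (ℤ.+<+ (ℕ.<-≤-trans lt (ℕ.m≤m+n t (a * t))))
  cross (ℚ.mkℚ (ℤ.-[1+ _ ]) _ _) () _

-- From counts to the limit

module _ {Ω : Set} (U : UniformSpace Ω) {P : Ω → Set} (P? : Decidable P) where

  open UniformSpace U

  -- The distance of a probability from one is the probability of the complementary event.
  ℙ-near-1 : ∀ {ε} → 0ℚ ℚ.< ε → length (filter (¬? ∘ P?) outcomes) * ↧ₙ ε < length outcomes →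
             ℚ.∣ ℙ U P? ℚ.- 1ℚ ∣ ℚ.< ε
  ℙ-near-1 {ε} 0<ε few = subst (ℚ._< ε) (sym distance) (/-<-positive bad total 0<ε few)
    where
    open ≡-Reasoning
    good = length (filter P? outcomes)
    bad = length (filter (¬? ∘ P?) outcomes)
    total = length outcomes
    instance _ = nonEmpty
    g = + good ℚ./ total
    b = + bad ℚ./ total
    0≤b : 0ℚ ℚ.≤ b
    0≤b = ℚ.nonNegative⁻¹ b {{ℚ.normalize-nonNeg bad total}}
    g+b≡1 : g ℚ.+ b ≡ 1ℚ
    g+b≡1 = trans (/-+-/ good bad total) (trans (cong (λ m → + m ℚ./ total) (length-filter-¬ P? outcomes)) (n/n≡1 total))
    distance : ℚ.∣ g ℚ.- 1ℚ ∣ ≡ b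
    distance = begin
      ℚ.∣ g ℚ.- 1ℚ ∣               ≡⟨ cong (λ x → ℚ.∣ g ℚ.- x ∣) g+b≡1 ⟨
      ℚ.∣ g ℚ.- (g ℚ.+ b) ∣        ≡⟨ cong (λ x → ℚ.∣ g ℚ.+ x ∣) (ℚ.neg-distrib-+ g b) ⟩
      ℚ.∣ g ℚ.+ (ℚ.- g ℚ.- b) ∣    ≡⟨ cong ℚ.∣_∣ (ℚ.+-assoc g (ℚ.- g) (ℚ.- b)) ⟨
      ℚ.∣ g ℚ.- g ℚ.- b ∣          ≡⟨ cong (λ x → ℚ.∣ x ℚ.- b ∣) (ℚ.+-inverseʳ g) ⟩
      ℚ.∣ 0ℚ ℚ.- b ∣               ≡⟨ cong ℚ.∣_∣ (ℚ.+-identityˡ (ℚ.- b)) ⟩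
      ℚ.∣ ℚ.- b ∣                  ≡⟨ ℚ.∣-p∣≡∣p∣ b ⟩
      ℚ.∣ b ∣                      ≡⟨ ℚ.0≤p⇒∣p∣≡p 0≤b ⟩
      b                            ∎

-- Read as fractions: `B / T` is at most `nK / S`, which is below `1 / e` because `S` exceeds
-- `n(K + 1)e`. Strictness comes from `K < suc K`.
few-bad : ∀ {B T K n e S} → .{{NonZero n}} → .{{NonZero T}} →
  B * S ≤ n * (T * K) → n * (suc K * e) < S → B * e < T
few-bad {B} {T} {K} {n} {e} {S} bound small = ℕ.≰⇒> λ T≤Be → ℕ.<⇒≱ (begin-strict
    n * (T * K)          <⟨ ℕ.*-monoʳ-< n (ℕ.*-monoʳ-< T (ℕ.n<1+n K)) ⟩
    n * (T * suc K)      ≤⟨ ℕ.*-monoʳ-≤ n (ℕ.*-monoˡ-≤ (suc K) T≤Be) ⟩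
    n * (B * e * suc K)  ≡⟨ regroup n B e (suc K) ⟩
    B * (n * (suc K * e)) ≤⟨ ℕ.*-monoʳ-≤ B (ℕ.<⇒≤ small) ⟩
    B * S                ∎) bound
  where
  open ℕ.≤-Reasoning
  regroup : ∀ n B e K → n * (B * e * K) ≡ B * (n * (K * e))
  regroup = solve-∀

theorem2p2 : (c k : ℕ) → 1 ≤ c → 1 ≤ k → c ≤ k →
    (s : ℕ → ℕ) (c≤s : ∀ n → c ≤ s n) →
    s ≫root (c * c) →
    (λ n → p n c k (s n) (c≤s n)) ⟶ 1ℚ
-- Beyond `N` the growth of `s` takes effect; adding `M` ensures that a window fits into the cycle
-- without overlapping itself.
theorem2p2 c k 1≤c 1≤k c≤k s c≤s s≫ ε 0<ε = N + M , near
  where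
  M d : ℕ
  M = c * c * (k + k)
  -- The truncated subtraction is exact by `c²≤cM`.
  d = c * M ∸ c * c
  K = patternBound c M d
  -- The growth hypothesis is applied with `1 / q`: the factor `suc K` absorbs the constant of the
  -- union bound, the other one reaches the target `ε`.
  q = suc K * ↧ₙ ε
  instance
    c≢0 : NonZero c
    c≢0 = ℕ.>-nonZero 1≤c
    c²≢0 : NonZero (c * c)
    c²≢0 = ℕ.m*n≢0 c c
    M≢0 : NonZero M
    M≢0 = ℕ.m*n≢0 (c * c) (k + k) {{c²≢0}} {{ℕ.>-nonZero (ℕ.≤-trans 1≤k (ℕ.m≤m+n k k))}}

  c²≤cM : c * c ≤ c * M
  c²≤cM = begin
    c * c                     ≡⟨ ℕ.*-identityʳ (c * c) ⟨
    c * c * 1                 ≤⟨ ℕ.*-monoʳ-≤ (c * c) (ℕ.≤-trans 1≤k (ℕ.m≤m+n k k)) ⟩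
    M                         ≡⟨ ℕ.*-identityˡ M ⟨
    1 * M                     ≤⟨ ℕ.*-monoˡ-≤ M 1≤c ⟩
    c * M                     ∎
    where open ℕ.≤-Reasoning

  eventually : ∃ λ N → ∀ n → N ≤ n → n ^1/ (c * c) < ((+ 1 ℚ./ q) ℚ.* fromℕ (s n))
  eventually = s≫ (+ 1 ℚ./ q) (ℚ.positive⁻¹ (+ 1 ℚ./ q) {{ℚ.normalize-pos 1 q}})
  N = proj₁ eventually

  near : ∀ n → N + M ≤ n → ℚ.∣ p n c k (s n) (c≤s n) ℚ.- 1ℚ ∣ ℚ.< ε
  near n N+M≤n = ℙ-near-1 (randomLists n (c≤s n)) _ 0<ε
    (few-bad {B = length (filter (uncolourable? n k) (listAssignments n c (s n)))} {S = s n ^ (c * c)} {{n≢0}} {{UniformSpace.nonEmpty (randomLists n (c≤s n))}}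
      (uncolourable-count {{n≢0}} 1≤c 1≤k (c≤s n) refl (ℕ.m∸n+n≡m c²≤cM) M≤n)
      (ℕ.≤-<-trans (ℕ.*-monoʳ-≤ n q≤) (root-bound {n} {c * c} {s n} q (proj₂ eventually n (ℕ.≤-trans (ℕ.m≤m+n N M) N+M≤n)))))
    where
    M≤n : M ≤ n
    M≤n = ℕ.≤-trans (ℕ.m≤n+m M N) N+M≤n
    n≢0 : NonZero n
    n≢0 = ℕ.>-nonZero (ℕ.≤-trans (ℕ.>-nonZero⁻¹ M) M≤n)
    -- The growth hypothesis supplies the power `q ^ (c * c)`, while `few-bad` asks for `q` itself;
    -- the exponent is at least one.
    q≤ : q ≤ q ^ (c * c)
    q≤ = ℕ.≤-trans (ℕ.≤-reflexive (sym (ℕ.^-identityʳ q))) (ℕ.^-monoʳ-≤ q (ℕ.>-nonZero⁻¹ (c * c)))
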